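{- Each of the permutation groups $A_4(6)$, $S_4(6d)$ and $S_4(6c)$ is of exponential type. That is, for each $L\in\{A_4(6),S_4(6d),S_4(6c)\}$ there exist constants $c>0$ and $\beta>1$ and an infinite family $\{(\Gamma_n,G_n)\}_{n\in\mathbb{N}}$ of locally-$L$ pairs, with $|\mathrm{V}(\Gamma_n)|$ unbounded, such that for every arc $(u,v)$ of $\Gamma_n$ we have $|(G_n)_{uv}|\ge c\,\beta^{|\mathrm{V}(\Gamma_n)|}$.
   Context: All graphs are finite, connected, simple and undirected. An arc of a graph $\Gamma$ is an ordered pair of adjacent vertices; $\mathrm{V}(\Gamma)$ denotes the vertex set. A graph $\Gamma$ is $G$-arc-transitive if $G\le\mathrm{Aut}(\Gamma)$ acts transitively on the arcs of $\Gamma$. For such $G$ and a vertex $v$, let $G_v^{\Gamma(v)}$ be the permutation group induced by the vertex-stabiliser $G_v$ on the neighbourhood $\Gamma(v)$ of $v$; it is transitive and independent of $v$ up to permutation isomorphism. If $L$ is a permutation group permutationally isomorphic to $G_v^{\Gamma(v)}$, the pair $(\Gamma,G)$ (with $\Gamma$ connected, finite and $G$-arc-transitive) is called locally-$L$. $G_{uv}$ denotes the stabiliser in $G$ of both $u$ and $v$. A transitive permutation group $L$ is of exponential type if there is an exponential function $g_L$ and an infinite family of locally-$L$ pairs $(\Gamma_n,G_n)$ with $|(G_n)_{uv}|\ge g_L(|\mathrm{V}(\Gamma_n)|)$ for arcs $(u,v)$ of $\Gamma_n$. The groups: $A_4(6)$ is $\mathrm{Alt}(4)$ acting on the right cosets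 of $\langle (1\,2)(3\,4)\rangle$; $S_4(6d)$ is $\mathrm{Sym}(4)$ acting on the cosets of $\langle (1\,2),(3\,4)\rangle$; $S_4(6c)$ is $\mathrm{Sym}(4)$ acting on the cosets of $\langle (1\,2\,3\,4)\rangle$ (all of degree $6$). -}

module Defs where

open import Data.Nat as ℕ using (ℕ; zero; suc; _≤_; _<_; _%_)
open import Data.Fin as Fin using (Fin)
open import Data.Fin.Properties as FinP using ()
open import Data.Vec as Vec using (Vec; []; _∷_; lookup; tabulate; allFin; toList)
open import Data.Vec.Properties using (≡-dec)
open import Data.List as List using (List; []; _∷_; [_]; length; filter; map; concatMap; _++_)
open import Data.List.Membership.Propositional using (_∈_)
open import Data.List.Relation.Unary.Any as Any using (Any; any?)
open import Data.List.Relation.Unary.Unique.Propositional using (Unique)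
import Data.List.Relation.Unary.Unique.DecPropositional as UniqueDec
open import Data.Bool using (Bool; true; false)
open import Data.Product using (Σ; ∃-syntax; _×_; _,_)
open import Relation.Binary.PropositionalEquality using (_≡_)
open import Relation.Nullary using (Dec; yes; no; ¬_)
open import Relation.Nullary.Decidable using (_×-dec_)
open import Function.Bundles using (_⇔_)
open import Data.Rational as ℚ using (ℚ; 0ℚ; 1ℚ)
open import Data.Integer using (+_)

-- Permutations of Fin n, written as the vector of images of 0,1,…,n-1.
-- We use right actions: the image of i under p is  lookup p i,
-- and  p · q  means "first p, then q"  (i^(pq) = (i^p)^q).

Perm : ℕ → Set
Perm n = Vec (Fin n) n

_≟P_ : ∀ {n} (p q : Perm n) → Dec (p ≡ q)
_≟P_ = ≡-dec FinP._≟_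

infixl 7 _·_
_·_ : ∀ {n} → Perm n → Perm n → Perm n
p · q = tabulate (λ i → lookup q (lookup p i))

idPerm : ∀ {n} → Perm n
idPerm = allFin _

IsPerm : ∀ {n} → Perm n → Set
IsPerm p = Unique (toList p)

isPerm? : ∀ {n} (p : Perm n) → Dec (IsPerm p)
isPerm? p = UniqueDec.unique? FinP._≟_ (toList p)

allVecs : ∀ {n} (m : ℕ) → List (Vec (Fin n) m)
allVecs zero    = [ [] ]
allVecs {n} (suc m) = concatMap (λ i → map (i ∷_) (allVecs m)) (toList (allFin n))

Sym : (n : ℕ) → List (Perm n)
Sym n = filter isPerm? (allVecs n)

inversions : ∀ {n} → Perm n → ℕ
inversions {n} p =
  length (filter (λ ij → (Data.Product.proj₁ ij Fin.<? Data.Product.proj₂ ij)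
                          ×-dec (lookup p (Data.Product.proj₂ ij) Fin.<? lookup p (Data.Product.proj₁ ij)))
                 (List.cartesianProduct (toList (allFin n)) (toList (allFin n))))

Alt : (n : ℕ) → List (Perm n)
Alt n = filter (λ p → inversions p % 2 ℕ.≟ 0) (Sym n)

InCoset : ∀ {m} → List (Perm m) → Perm m → Perm m → Set
InCoset H t g = Any (λ h → h · t ≡ g) H

inCoset? : ∀ {m} (H : List (Perm m)) (t g : Perm m) → Dec (InCoset H t g)
inCoset? H t g = any? (λ h → (h · t) ≟P g) H

transversal : ∀ {m} → List (Perm m) → List (Perm m) → List (Perm m)
transversal {m} H K = go [] K
  where
  go : List (Perm m) → List (Perm m) → List (Perm m)
  go T [] = T
  go T (g ∷ gs) with any? (λ t → inCoset? H t g) T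
  ... | yes _ = go T gs
  ... | no  _ = go (T ++ [ g ]) gs

cosetIndex : ∀ {m} (H T : List (Perm m)) → Perm m → Fin (length T) → Fin (length T)
cosetIndex H T g dflt with any? (λ t → inCoset? H t g) T
... | yes a = Any.index a
... | no  _ = dflt

record PermGroup : Set where
  field
    deg    : ℕ
    elems  : List (Perm deg)
open PermGroup public

-- K acting on the right cosets of H by right multiplication: Hx ↦ Hxk.
-- Points are the cosets H t for t in the transversal, labelled 0,…,|K:H|-1.
cosetAction : ∀ {m} → (K H : List (Perm m)) → PermGroup
cosetAction K H = record
  { deg   = length T
  ; elems = map (λ k → tabulate (λ i → cosetIndex H T (List.lookup T i · k) i)) K }
  where T = transversal H K

-- points 1,2,3,4 of the paper are 0,1,2,3 here
-- ⟨(1 2)(3 4)⟩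
H-A4-6 : List (Perm 4)
H-A4-6 = idPerm ∷ (Fin.# 1 ∷ Fin.# 0 ∷ Fin.# 3 ∷ Fin.# 2 ∷ []) ∷ []

-- ⟨(1 2), (3 4)⟩
H-S4-6d : List (Perm 4)
H-S4-6d = idPerm
        ∷ (Fin.# 1 ∷ Fin.# 0 ∷ Fin.# 2 ∷ Fin.# 3 ∷ [])
        ∷ (Fin.# 0 ∷ Fin.# 1 ∷ Fin.# 3 ∷ Fin.# 2 ∷ [])
        ∷ (Fin.# 1 ∷ Fin.# 0 ∷ Fin.# 3 ∷ Fin.# 2 ∷ [])
        ∷ []

-- ⟨(1 2 3 4)⟩
H-S4-6c : List (Perm 4)
H-S4-6c = idPerm
        ∷ (Fin.# 1 ∷ Fin.# 2 ∷ Fin.# 3 ∷ Fin.# 0 ∷ [])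
        ∷ (Fin.# 2 ∷ Fin.# 3 ∷ Fin.# 0 ∷ Fin.# 1 ∷ [])
        ∷ (Fin.# 3 ∷ Fin.# 0 ∷ Fin.# 1 ∷ Fin.# 2 ∷ [])
        ∷ []

A4[6] : PermGroup
A4[6] = cosetAction (Alt 4) H-A4-6

S4[6d] : PermGroup
S4[6d] = cosetAction (Sym 4) H-S4-6d

S4[6c] : PermGroup
S4[6c] = cosetAction (Sym 4) H-S4-6c

data Walk {N : ℕ} (adj : Fin N → Fin N → Bool) : Fin N → Fin N → Set where
  here : ∀ {v} → Walk adj v v
  step : ∀ {u w v} → adj u w ≡ true → Walk adj w v → Walk adj u v

-- the vertex-stabiliser G_v induces on Γ(v) a group permutationally
-- isomorphic to L, via the bijection φ : {0,…,deg L - 1} → Γ(v):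
-- { φ⁻¹ g|_{Γ(v)} φ : g ∈ G_v } = L  as sets of permutations.
record LocalActionIso {N : ℕ} (adj : Fin N → Fin N → Bool) (G : List (Perm N))
                      (L : PermGroup) (v : Fin N) : Set where
  field
    φ        : Fin (deg L) → Fin N
    φ-inj    : ∀ i j → φ i ≡ φ j → i ≡ j
    φ-onto   : ∀ w → (adj v w ≡ true) ⇔ (∃[ i ] φ i ≡ w)
    restr⊆L  : ∀ g → g ∈ G → lookup g v ≡ v →
               ∃[ σ ] (σ ∈ elems L × (∀ i → lookup g (φ i) ≡ φ (lookup σ i)))
    L⊆restr  : ∀ σ → σ ∈ elems L →
               ∃[ g ] (g ∈ G × lookup g v ≡ v × (∀ i → lookup g (φ i) ≡ φ (lookup σ i)))

record LocallyPair (L : PermGroup) : Set where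
  field
    N          : ℕ
    nonempty   : 0 < N
    adj        : Fin N → Fin N → Bool
    adj-sym    : ∀ u v → adj u v ≡ adj v u
    adj-irrefl : ∀ v → adj v v ≡ false
    connected  : ∀ u v → Walk adj u v
    G          : List (Perm N)
    G-unique   : Unique G
    G-perm     : ∀ g → g ∈ G → IsPerm g
    G-aut      : ∀ g → g ∈ G → ∀ u v → adj (lookup g u) (lookup g v) ≡ adj u v
    G-id       : idPerm ∈ G
    G-comp     : ∀ g h → g ∈ G → h ∈ G → g · h ∈ G
    arcTrans   : ∀ u v u′ v′ → adj u v ≡ true → adj u′ v′ ≡ true →
                 ∃[ g ] (g ∈ G × lookup g u ≡ u′ × lookup g v ≡ v′)
    locally    : ∀ v → LocalActionIso adj G L v
open LocallyPair public

arcStab : ∀ {N} → List (Perm N) → Fin N → Fin N → List (Perm N)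
arcStab G u v = filter (λ g → (lookup g u FinP.≟ u) ×-dec (lookup g v FinP.≟ v)) G

_^ℚ_ : ℚ → ℕ → ℚ
β ^ℚ zero  = 1ℚ
β ^ℚ suc n = β ℚ.* (β ^ℚ n)

ExponentialType : PermGroup → Set
ExponentialType L =
  ∃[ c ] ∃[ β ] (0ℚ ℚ.< c × 1ℚ ℚ.< β ×
    Σ (ℕ → LocallyPair L) (λ F →
      (∀ m → ∃[ n ] m ≤ N (F n)) ×
      (∀ n u v → adj (F n) u v ≡ true →
         c ℚ.* (β ^ℚ N (F n)) ℚ.≤ ((+ length (arcStab (G (F n)) u v)) ℚ./ 1))))

{-# OPTIONS --safe #-}

-- Take a cubic graph Λ on which a group acts transitively on the arcs, also with reflections
-- at the vertices, and replace every vertex by two copies. The code C of bit vectors on V(Λ)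
-- with even sum over every neighbourhood acts by swapping copies, and together with the
-- group of Λ it induces on a neighbourhood 2² ⋊ C₃ = A₄(6) or 2² ⋊ S₃ = S₄(6d); if every
-- reflection is combined with swapping all copies, 2² ⋊ S₃ becomes S₄(6c). The arc
-- stabiliser contains a subgroup of C of index at most 4, so Λ has to be such that dim C is
-- linear in |V(Λ)|.
--
-- Let Λ be the coset graph of a group D generated by a of order 3 and t of order 2, with
-- arcs x ∈ D, and let ξ be a function on D satisfying ξ(tat x) = ξ(x) and
-- ξ(atat x) = ξ(a x). Then x ↦ φ(ξ(t x)) + φ(ξ(a t x)) is a word of C for every φ, because
-- its sum over a neighbourhood telescopes, and it determines φ up to two bits. Thus it
-- suffices that ξ takes at least |D| / K values with K fixed. In Dih(n) ≀ Sym(9) there are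
-- such D, growing with n, with ξ(x) = P ∘ x for a set P that meets each of the nine blocks
-- in one point: P ∘ x determines x up to boundedly many choices.

module Submission where

open import Defs
open import Data.Nat as ℕ using (ℕ; zero; suc; _≤_; _<_; z≤n)
import Data.Nat.Properties as ℕP
open import Data.Fin as Fin using (Fin; zero; suc; punchOut; combine; remQuot)
open import Data.Fin.Properties as FinP using (any?; all?; injective⇒≤; punchOut-injective; suc-injective; ¬∀⟶∃¬)
open import Data.Product using (∃-syntax; _×_; _,_; proj₁; proj₂)
import Data.Product.Properties as ×P
open import Function.Base using (_∘_)
open import Function.Bundles using (mk⇔)
open import Relation.Binary.PropositionalEquality
open import Relation.Nullary using (Dec; yes; no; ¬_; contradiction)
open import Relation.Nullary.Decidable using (_×-dec_; _→-dec_; map′; True; toWitness; does; dec-true; dec-false; does-⇔)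
open import Data.Bool as Bool using (Bool; true; false; _∧_; _xor_)
import Data.Bool.Properties as BoolP
open import Data.Vec as Vec using (Vec; []; _∷_; lookup; tabulate)
import Data.Vec.Properties as VecP
open import Data.List as List using (List; []; _∷_; filter; map; cartesianProduct; length)
open import Data.List.Membership.Propositional using (_∈_)
import Data.List.Membership.Propositional.Properties as ∈P
import Data.List.Membership.DecPropositional as DecMem
open import Data.List.Relation.Unary.All as All using (All)
open import Data.List.Relation.Unary.Any as Any using (here; there)
open import Data.List.Relation.Unary.Unique.Propositional using (Unique)
import Data.List.Relation.Unary.Unique.Propositional.Properties as UniqueP
import Data.List.Relation.Unary.Unique.DecPropositional.Properties as UniqueDP
open import Data.Vec.Membership.Propositional.Properties using (∈-toList⁺; ∈-allFin⁺)
import Data.List.Relation.Unary.AllPairs as AllPairs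
import Data.List.Relation.Unary.Any.Properties as AnyP
open import Data.Fin.Induction using (<-weakInduction)
open import Data.Integer as ℤ using (+_)
import Data.Integer.Properties as ℤP
open import Data.Rational as ℚ using (ℚ; 1ℚ)
import Data.Rational.Properties as ℚP
open import Data.Rational.Unnormalised using (mkℚᵘ; *≡*; *≤*)
import Data.Rational.Unnormalised.Properties as ℚᵘP

-- Finite sets

Inj : ∀ {A B : Set} → (A → B) → Set
Inj f = ∀ x y → f x ≡ f y → x ≡ y

injection-≤ : ∀ {m n} (f : Fin m → Fin n) → Inj f → m ≤ n
injection-≤ f f-inj = injective⇒≤ {f = f} (λ {x} {y} → f-inj x y)

-- A missed value could be punched out of the codomain, leaving an injection into a smaller set.
-- This supplies inverses where only injectivity is carried along, as for the symmetries of the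
-- arcs.
injective⇒onto : ∀ {n} (f : Fin n → Fin n) → Inj f → ∀ y → ∃[ x ] f x ≡ y
injective⇒onto {suc n} f f-inj y with any? (λ x → f x FinP.≟ y)
... | yes found = found
... | no missed = contradiction (injection-≤ g g-inj) ℕP.1+n≰n
  where
  y≢ : ∀ x → y ≢ f x
  y≢ x eq = missed (x , sym eq)
  g : Fin (suc n) → Fin n
  g x = punchOut (y≢ x)
  g-inj : Inj g
  g-inj x x′ eq = f-inj x x′ (punchOut-injective (y≢ x) (y≢ x′) eq)

record Equivalence {d} (_~_ : Fin d → Fin d → Set) : Set where
  field
    ~-refl  : ∀ x → x ~ x
    ~-sym   : ∀ {x y} → x ~ y → y ~ x
    ~-trans : ∀ {x y z} → x ~ y → y ~ z → x ~ z
    ~-dec   : ∀ x y → Dec (x ~ y)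

record Quotient {d} (_~_ : Fin d → Fin d → Set) : Set where
  field
    size     : ℕ
    cls      : Fin d → Fin size
    rep      : Fin size → Fin d
    cls-rep  : ∀ v → cls (rep v) ≡ v
    rep-cls  : ∀ x → rep (cls x) ~ x
    cls-cong : ∀ {x y} → x ~ y → cls x ≡ cls y

-- Recursion on `d`: the point `zero` joins the class of a later point related to it, or else opens
-- a new class. Both the vertices, as sets of arcs, and the values of `ξ` arise this way.
quotient : ∀ {d} (_~_ : Fin d → Fin d → Set) → Equivalence _~_ → Quotient _~_
quotient {zero} _~_ E = record
  { size = 0 ; cls = λ () ; rep = λ () ; cls-rep = λ () ; rep-cls = λ ()
  ; cls-cong = λ { {()} } }
quotient {suc d} _~_ E = extend (any? (λ y → ~-dec zero (suc y)))
  where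
  open Equivalence E
  Q : Quotient (λ x y → suc x ~ suc y)
  Q = quotient _ record { ~-refl = λ x → ~-refl (suc x) ; ~-sym = ~-sym
                        ; ~-trans = ~-trans ; ~-dec = λ x y → ~-dec (suc x) (suc y) }
  open Quotient Q
  extend : Dec (∃[ y ] zero ~ suc y) → Quotient _~_
  extend (yes (y , 0~y)) = record
    { size = size ; cls = cls′ ; rep = λ v → suc (rep v) ; cls-rep = cls-rep
    ; rep-cls = λ { zero → ~-trans (rep-cls y) (~-sym 0~y) ; (suc x) → rep-cls x }
    ; cls-cong = λ {x} {x′} → congruent x x′ }
    where
    cls′ : Fin (suc d) → Fin size
    cls′ zero    = cls y
    cls′ (suc x) = cls x
    congruent : ∀ x x′ → x ~ x′ → cls′ x ≡ cls′ x′
    congruent zero    zero     p = refl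
    congruent zero    (suc x′) p = cls-cong (~-trans (~-sym 0~y) p)
    congruent (suc x) zero     p = cls-cong (~-trans p 0~y)
    congruent (suc x) (suc x′) p = cls-cong p
  extend (no 0≁) = record
    { size = suc size ; cls = cls′ ; rep = rep′
    ; cls-rep = λ { zero → refl ; (suc v) → cong suc (cls-rep v) }
    ; rep-cls = λ { zero → ~-refl zero ; (suc x) → rep-cls x }
    ; cls-cong = λ {x} {x′} → congruent x x′ }
    where
    cls′ : Fin (suc d) → Fin (suc size)
    cls′ zero    = zero
    cls′ (suc x) = suc (cls x)
    rep′ : Fin (suc size) → Fin (suc d)
    rep′ zero    = zero
    rep′ (suc v) = suc (rep v)
    congruent : ∀ x x′ → x ~ x′ → cls′ x ≡ cls′ x′
    congruent zero    zero     p = refl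
    congruent zero    (suc x′) p = contradiction (x′ , p) 0≁
    congruent (suc x) zero     p = contradiction (x , ~-sym p) 0≁
    congruent (suc x) (suc x′) p = cong suc (cls-cong p)

module _ {X : Set} (r : X) (A T : X → X) where

  data Reach : X → Set where
    start : Reach r
    viaA : ∀ {x} → Reach x → Reach (A x)
    viaT : ∀ {x} → Reach x → Reach (T x)

  record Orbit : Set where
    field
      size   : ℕ
      el     : Fin size → X
      el-inj : Inj el
      reach  : ∀ x → Reach (el x)
      index  : ∀ {y} → Reach y → Fin size
      el-index : ∀ {y} (p : Reach y) → el (index p) ≡ y

  module _ {B} (code : X → Fin B) (code-inj : Inj code) where

    private
      _≟X_ : (x y : X) → Dec (x ≡ y)
      x ≟X y = map′ (code-inj x y) (cong code) (code x FinP.≟ code y)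

      -- Each round adds one point, until the list is closed under `A` and `T`. If the fuel runs
      -- out, the list has more than `B` points, which `code-inj` forbids.
      grow : ∀ fuel s (el : Fin (suc s) → X) → Inj el → el zero ≡ r →
             (∀ x → Reach (el x)) → B < suc s ℕ.+ fuel → Orbit
      grow zero s el el-inj el0 rch lt = contradiction
        (ℕP.<-≤-trans (subst (B <_) (ℕP.+-identityʳ (suc s)) lt)
          (injection-≤ (λ x → code (el x)) (λ x y eq → el-inj x y (code-inj _ _ eq))))
        (ℕP.<-irrefl refl)
      grow (suc fuel) s el el-inj el0 rch lt = go (all? closed?)
        where
        Has : X → Set
        Has y = ∃[ x ] el x ≡ y
        has? : ∀ y → Dec (Has y)
        has? y = any? (λ x → el x ≟X y)
        Closed : Fin (suc s) → Set
        Closed x = Has (A (el x)) × Has (T (el x))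
        closed? : ∀ x → Dec (Closed x)
        closed? x = has? (A (el x)) ×-dec has? (T (el x))
        add : ∀ y → Reach y → ¬ Has y → Orbit
        add y yr fresh = grow fuel (suc s) el′ el′-inj el0 rch′
                           (subst (B <_) (ℕP.+-suc (suc s) fuel) lt)
          where
          el′ : Fin (suc (suc s)) → X
          -- The new point takes the second place, so that the root stays first and `el0` carries
          -- over unchanged.
          el′ zero          = el zero
          el′ (suc zero)    = y
          el′ (suc (suc x)) = el (suc x)
          el′-inj : Inj el′
          el′-inj zero          zero          eq = refl
          el′-inj zero          (suc zero)    eq = contradiction (zero , eq) fresh
          el′-inj zero          (suc (suc x′)) eq with () ← el-inj zero (suc x′) eq
          el′-inj (suc zero)    zero          eq = contradiction (zero , sym eq) fresh
          el′-inj (suc zero)    (suc zero)    eq = refl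
          el′-inj (suc zero)    (suc (suc x′)) eq = contradiction (suc x′ , sym eq) fresh
          el′-inj (suc (suc x)) zero          eq with () ← el-inj (suc x) zero eq
          el′-inj (suc (suc x)) (suc zero)    eq = contradiction (suc x , eq) fresh
          el′-inj (suc (suc x)) (suc (suc x′)) eq = cong suc (el-inj (suc x) (suc x′) eq)
          rch′ : ∀ x → Reach (el′ x)
          rch′ zero          = rch zero
          rch′ (suc zero)    = yr
          rch′ (suc (suc x)) = rch (suc x)
        go : Dec (∀ x → Closed x) → Orbit
        go (yes closed) = record
          { size = suc s ; el = el ; el-inj = el-inj ; reach = rch
          ; index = λ p → proj₁ (has p) ; el-index = λ p → proj₂ (has p) }
          where
          has : ∀ {y} → Reach y → Has y
          has start = zero , el0
          has (viaA p) = let x , eq = has p ; x′ , eq′ = proj₁ (closed x)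
                         in x′ , trans eq′ (cong A eq)
          has (viaT p) = let x , eq = has p ; x′ , eq′ = proj₂ (closed x)
                         in x′ , trans eq′ (cong T eq)
        go (no ¬closed) with x , ¬cx ← ¬∀⟶∃¬ _ Closed closed? ¬closed
                        with has? (A (el x)) | has? (T (el x))
        ... | no ¬a  | _      = add (A (el x)) (viaA (rch x)) ¬a
        ... | yes _  | no ¬t  = add (T (el x)) (viaT (rch x)) ¬t
        ... | yes ha | yes ht = contradiction (ha , ht) ¬cx

    -- Only the specification in `Orbit` matters later; the search itself should never be unfolded.
    abstract
      orbit : Orbit
      orbit = grow B 0 (λ _ → r) (λ { zero zero _ → refl }) refl (λ _ → start) ℕP.≤-refl

-- The local actions

rot : Fin 3 → Fin 3
rot zero             = suc zero
rot (suc zero)       = suc (suc zero)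
rot (suc (suc zero)) = zero

-- Modulo 3 this is `i + k` for `false` and `k - i` for `true`, so the pairs of a bit and `k`
-- enumerate Sym(3).
turn : Bool → Fin 3 → Fin 3 → Fin 3
turn false zero             i = i
turn false (suc zero)       i = rot i
turn false (suc (suc zero)) i = rot (rot i)
turn true  k zero             = k
turn true  k (suc zero)       = rot (rot k)
turn true  k (suc (suc zero)) = rot k

act : Bool → Fin 3 → (Fin 3 → Bool) → Fin 3 × Bool → Fin 3 × Bool
act b k c (i , e) = turn b k i , e xor c i

Σ₃ : (Fin 3 → Bool) → Bool
Σ₃ c = c zero xor (c (suc zero) xor c (suc (suc zero)))

-- The degree-6 groups as groups of permutations of three blocks of size two:
-- the blocks are turned cyclically, possibly (if refl?) after a reflection b, and the
-- bits c added inside the blocks have sum b ∧ tw.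
Admissible : Bool → Bool → Bool → (Fin 3 → Bool) → Set
Admissible refl? tw b c = b ∧ refl? ≡ b × Σ₃ c ≡ b ∧ tw

-- The construction of the pairs sees `L` only through this record. `A4[6]` has neither flag,
-- `S4[6d]` has `refl?`, and `S4[6c]` has both.
record LocalModel (L : PermGroup) (refl? tw : Bool) : Set where
  field
    pt    : Fin (deg L) → Fin 3 × Bool
    tp    : Fin 3 × Bool → Fin (deg L)
    pt-tp : ∀ x → pt (tp x) ≡ x
    tp-pt : ∀ i → tp (pt i) ≡ i
    sound : ∀ σ → σ ∈ elems L → ∃[ b ] ∃[ k ] ∃[ c ]
            (Admissible refl? tw b c × (∀ i → pt (lookup σ i) ≡ act b k c (pt i)))
    complete : ∀ b k c → Admissible refl? tw b c →
               ∃[ σ ] (σ ∈ elems L × (∀ i → pt (lookup σ i) ≡ act b k c (pt i)))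

module Check (pts : Vec (Fin 3 × Bool) 6) (tps₀ tps₁ : Vec (Fin 6) 3) where

  pt : Fin 6 → Fin 3 × Bool
  pt = lookup pts

  tp : Fin 3 × Bool → Fin 6
  tp (i , false) = lookup tps₀ i
  tp (i , true)  = lookup tps₁ i

  Param : Set
  Param = Bool × Fin 3 × Bool × Bool × Bool

  bits : Bool → Bool → Bool → Fin 3 → Bool
  bits x y z = lookup (x ∷ y ∷ z ∷ [])

  bits-eta : ∀ (c : Fin 3 → Bool) i → bits (c zero) (c (suc zero)) (c (suc (suc zero))) i ≡ c i
  bits-eta c zero             = refl
  bits-eta c (suc zero)       = refl
  bits-eta c (suc (suc zero)) = refl

  modelPerm : Param → Perm 6
  modelPerm (b , k , x , y , z) = tabulate λ i → tp (act b k (bits x y z) (pt i))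

  bools : List Bool
  bools = false ∷ true ∷ []

  ∈-bools : ∀ b → b ∈ bools
  ∈-bools false = here refl
  ∈-bools true  = there (here refl)

  params : List Param
  params = cartesianProduct bools (cartesianProduct (List.allFin 3)
             (cartesianProduct bools (cartesianProduct bools bools)))

  ∈-params : ∀ p → p ∈ params
  ∈-params (b , k , x , y , z) =
    ∈P.∈-cartesianProduct⁺ (∈-bools b) (∈P.∈-cartesianProduct⁺ (∈P.∈-allFin k)
      (∈P.∈-cartesianProduct⁺ (∈-bools x) (∈P.∈-cartesianProduct⁺ (∈-bools y) (∈-bools z))))

  Adm : Bool → Bool → Param → Set
  Adm refl? tw (b , k , x , y , z) = Admissible refl? tw b (bits x y z)

  adm? : ∀ refl? tw p → Dec (Adm refl? tw p)
  adm? refl? tw (b , k , x , y , z) =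
    (b ∧ refl? BoolP.≟ b) ×-dec (Σ₃ (bits x y z) BoolP.≟ b ∧ tw)

  model : Bool → Bool → List (Perm 6)
  model refl? tw = map modelPerm (filter (adm? refl? tw) params)

  open DecMem (_≟P_ {6}) using (_∈?_)

  SameAs : List (Perm 6) → List (Perm 6) → Set
  SameAs xs ys = All (_∈ ys) xs × All (_∈ xs) ys

  sameAs? : ∀ xs ys → Dec (SameAs xs ys)
  sameAs? xs ys = All.all? (_∈? ys) xs ×-dec All.all? (_∈? xs) ys

  Inverse : Set
  Inverse = (∀ i b → pt (tp (i , b)) ≡ (i , b)) × (∀ i → tp (pt i) ≡ i)

  localModel : ∀ es refl? tw → Inverse → SameAs es (model refl? tw) →
               LocalModel (record { deg = 6 ; elems = es }) refl? tw
  localModel es refl? tw (pt-tp , tp-pt) (es⊆ , ⊆es) = record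
    { pt = pt ; tp = tp ; pt-tp = λ x → pt-tp _ _ ; tp-pt = tp-pt
    ; sound = sound′ ; complete = complete′ }
    where
    acts : ∀ p → let b , k , x , y , z = p in
           ∀ i → pt (lookup (modelPerm p) i) ≡ act b k (bits x y z) (pt i)
    acts (b , k , x , y , z) i = 
      trans (cong pt (VecP.lookup∘tabulate (λ j → tp (act b k (bits x y z) (pt j))) i)) (pt-tp _ _)
    sound′ : ∀ σ → σ ∈ es → ∃[ b ] ∃[ k ] ∃[ c ]
             (Admissible refl? tw b c × (∀ i → pt (lookup σ i) ≡ act b k c (pt i)))
    sound′ σ σ∈ =
      let p , p∈ , eq = ∈P.∈-map⁻ modelPerm {xs = filter (adm? refl? tw) params} (All.lookup es⊆ σ∈)
          _ , adm = ∈P.∈-filter⁻ (adm? refl? tw) {v = p} {xs = params} p∈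
          b , k , x , y , z = p
      in b , k , bits x y z , adm ,
         λ i → trans (cong (λ τ → pt (lookup τ i)) eq) (acts p i)
    complete′ : ∀ b k c → Admissible refl? tw b c →
                ∃[ σ ] (σ ∈ es × (∀ i → pt (lookup σ i) ≡ act b k c (pt i)))
    complete′ b k c adm = modelPerm p
      , All.lookup ⊆es (∈P.∈-map⁺ modelPerm {x = p} {xs = filter (adm? refl? tw) params}
          (∈P.∈-filter⁺ (adm? refl? tw) {x = p} (∈-params p) adm))
      , λ i → trans (acts p i)
          (cong (turn b k (proj₁ (pt i)) ,_) (cong (proj₂ (pt i) xor_) (bits-eta c (proj₁ (pt i)))))
      where
      p : Param
      p = b , k , c zero , c (suc zero) , c (suc (suc zero))

  inverse? : Dec Inverse
  inverse? = all? (λ i → map′ (λ { (f , t) false → f ; (f , t) true → t })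
                              (λ h → h false , h true)
                              (eq? i false ×-dec eq? i true))
             ×-dec all? (λ i → tp (pt i) FinP.≟ i)
    where
    eq? : ∀ i b → Dec (pt (tp (i , b)) ≡ (i , b))
    eq? i b = ×P.≡-dec FinP._≟_ BoolP._≟_ (pt (tp (i , b))) (i , b)

  -- The implicit arguments are settled by evaluation: the admissible ones among the 48 parameters
  -- have to give the same permutations as `es`.
  check : ∀ es refl? tw → {True inverse?} → {True (sameAs? es (model refl? tw))} →
          LocalModel (record { deg = 6 ; elems = es }) refl? tw
  check es refl? tw {inv} {same} = localModel es refl? tw (toWitness inv) (toWitness same)

p₀ p₁ p₂ q₀ q₁ q₂ : Fin 3 × Bool
p₀ = zero , false
p₁ = suc zero , false
p₂ = suc (suc zero) , false
q₀ = zero , true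
q₁ = suc zero , true
q₂ = suc (suc zero) , true

-- The cosets are the edges of a tetrahedron, or the faces of a cube under its rotations; the blocks
-- `p₀ q₀`, `p₁ q₁`, `p₂ q₂` are the pairs of opposite edges or faces. The order of the points is
-- that in which `transversal` meets the cosets.
module TetrahedronEdges = Check (p₀ ∷ p₁ ∷ p₂ ∷ q₂ ∷ q₁ ∷ q₀ ∷ [])
  (Fin.# 0 ∷ Fin.# 1 ∷ Fin.# 2 ∷ []) (Fin.# 5 ∷ Fin.# 4 ∷ Fin.# 3 ∷ [])
module CubeFaces = Check (p₀ ∷ p₁ ∷ p₂ ∷ q₁ ∷ q₂ ∷ q₀ ∷ [])
  (Fin.# 0 ∷ Fin.# 1 ∷ Fin.# 2 ∷ []) (Fin.# 5 ∷ Fin.# 3 ∷ Fin.# 4 ∷ [])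

A4[6]-model : LocalModel A4[6] false false
A4[6]-model = TetrahedronEdges.check (elems A4[6]) false false

S4[6d]-model : LocalModel S4[6d] true false
S4[6d]-model = TetrahedronEdges.check (elems S4[6d]) true false

S4[6c]-model : LocalModel S4[6c] true true
S4[6c]-model = CubeFaces.check (elems S4[6c]) true true

-- Bit arithmetic


bool-all? : {P : Bool → Set} → (∀ b → Dec (P b)) → Dec (∀ b → P b)
bool-all? P? = map′ (λ { (f , t) false → f ; (f , t) true → t }) (λ h → h false , h true)
                    (P? false ×-dec P? true)

bool-any? : {P : Bool → Set} → (∀ b → Dec (P b)) → Dec (∃[ b ] P b)
bool-any? P? with P? false | P? true
... | yes p | _     = yes (false , p)
... | no _  | yes p = yes (true , p)
... | no ¬p | no ¬q = no λ { (false , p) → ¬p p ; (true , q) → ¬q q }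

turn-onto : ∀ b k i → ∃[ j ] turn b k j ≡ i
turn-onto = toWitness {a? = bool-all? λ b → all? λ k → all? λ i → any? λ j → turn b k j FinP.≟ i} _

turn-to : ∀ b i j → ∃[ k ] turn b k i ≡ j
turn-to = toWitness {a? = bool-all? λ b → all? λ i → all? λ j → any? λ k → turn b k i FinP.≟ j} _

turn-turn : ∀ b k b′ k′ → ∃[ l ] (∀ i → turn b′ k′ (turn b k i) ≡ turn (b xor b′) l i)
turn-turn = toWitness {a? = bool-all? λ b → all? λ k → bool-all? λ b′ → all? λ k′ →
  any? λ l → all? λ i → turn b′ k′ (turn b k i) FinP.≟ turn (b xor b′) l i} _

Σ₃-permutations : ∀ x y z →
  (y xor (z xor x) ≡ x xor (y xor z)) × (z xor (x xor y) ≡ x xor (y xor z)) ×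
  (x xor (z xor y) ≡ x xor (y xor z)) × (y xor (x xor z) ≡ x xor (y xor z)) ×
  (z xor (y xor x) ≡ x xor (y xor z))
Σ₃-permutations = toWitness {a? = bool-all? λ x → bool-all? λ y → bool-all? λ z →
  (y xor (z xor x) BoolP.≟ x xor (y xor z)) ×-dec (z xor (x xor y) BoolP.≟ x xor (y xor z)) ×-dec
  (x xor (z xor y) BoolP.≟ x xor (y xor z)) ×-dec (y xor (x xor z) BoolP.≟ x xor (y xor z)) ×-dec
  (z xor (y xor x) BoolP.≟ x xor (y xor z))} _

Σ₃-turn : ∀ b k (c : Fin 3 → Bool) → Σ₃ (c ∘ turn b k) ≡ Σ₃ c
Σ₃-turn b k c with Σ₃-permutations (c zero) (c (suc zero)) (c (suc (suc zero)))
Σ₃-turn false zero             c | _ = refl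
Σ₃-turn false (suc zero)       c | p , q , r , s , t = p
Σ₃-turn false (suc (suc zero)) c | p , q , r , s , t = q
Σ₃-turn true  zero             c | p , q , r , s , t = r
Σ₃-turn true  (suc zero)       c | p , q , r , s , t = s
Σ₃-turn true  (suc (suc zero)) c | p , q , r , s , t = t

Σ₃-cong : ∀ {c c′ : Fin 3 → Bool} → (∀ i → c i ≡ c′ i) → Σ₃ c ≡ Σ₃ c′
Σ₃-cong eq = cong₂ _xor_ (eq _) (cong₂ _xor_ (eq _) (eq _))

xor-interchange : ∀ x y z w → (x xor y) xor (z xor w) ≡ (x xor z) xor (y xor w)
xor-interchange = toWitness {a? = bool-all? λ x → bool-all? λ y → bool-all? λ z → bool-all? λ w →
  (x xor y) xor (z xor w) BoolP.≟ (x xor z) xor (y xor w)} _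

Σ₃-xor : ∀ (c c′ : Fin 3 → Bool) → Σ₃ (λ i → c i xor c′ i) ≡ Σ₃ c xor Σ₃ c′
Σ₃-xor c c′ = trans
  (cong ((c zero xor c′ zero) xor_) (xor-interchange (c (suc zero)) _ (c (suc (suc zero))) _))
  (xor-interchange (c zero) _ _ _)

Σ₃-const : ∀ s → Σ₃ (λ _ → s) ≡ s
Σ₃-const false = refl
Σ₃-const true  = refl

xor-cancelˡ : ∀ x y → x xor (x xor y) ≡ y
xor-cancelˡ false y     = refl
xor-cancelˡ true  false = refl
xor-cancelˡ true  true  = refl

xor-cancelʳ : ∀ x {y z} → y xor x ≡ z xor x → y ≡ z
xor-cancelʳ x {y} {z} eq = trans (sym (undo y)) (trans (cong (_xor x) eq) (undo z))
  where
  undo : ∀ w → (w xor x) xor x ≡ w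
  undo w = trans (BoolP.xor-assoc w x x)
                 (trans (cong (w xor_) (BoolP.xor-same x)) (BoolP.xor-identityʳ w))

-- Prescribes the entry at one position and repairs the parity at the cyclically next one.
evenWith : Fin 3 → Bool → Fin 3 → Bool
evenWith zero             x = lookup (x ∷ x ∷ false ∷ [])
evenWith (suc zero)       x = lookup (false ∷ x ∷ x ∷ [])
evenWith (suc (suc zero)) x = lookup (x ∷ false ∷ x ∷ [])

evenWith-even : ∀ i x → Σ₃ (evenWith i x) ≡ false
evenWith-even = toWitness {a? = all? λ i → bool-all? λ x → Σ₃ (evenWith i x) BoolP.≟ false} _

evenWith-at : ∀ i x → evenWith i x i ≡ x
evenWith-at = toWitness {a? = all? λ i → bool-all? λ x → evenWith i x i BoolP.≟ x} _

bit : Bool → Fin 2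
bit false = zero
bit true  = suc zero

unbit : Fin 2 → Bool
unbit zero       = false
unbit (suc zero) = true

unbit-bit : ∀ b → unbit (bit b) ≡ b
unbit-bit false = refl
unbit-bit true  = refl

bit-unbit : ∀ i → bit (unbit i) ≡ i
bit-unbit zero       = refl
bit-unbit (suc zero) = refl

-- Lists of permutations

∈-allVecs : ∀ {n} m (v : Vec (Fin n) m) → v ∈ allVecs m
∈-allVecs zero []      = here refl
∈-allVecs {n} (suc m) (i ∷ v) = ∈P.∈-concatMap⁺ (λ j → map (j ∷_) (allVecs m))
  (Any.map (λ { refl → ∈P.∈-map⁺ (i ∷_) (∈-allVecs m v) }) (∈-toList⁺ (∈-allFin⁺ i)))

lookup-ext : ∀ {A : Set} {n} {v w : Vec A n} → (∀ i → lookup v i ≡ lookup w i) → v ≡ w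
lookup-ext {v = v} {w} eq = trans (sym (VecP.tabulate∘lookup v))
  (trans (VecP.tabulate-cong eq) (VecP.tabulate∘lookup w))

lookup-injective⇒Unique : ∀ {A : Set} {n} (v : Vec A n) → Inj (lookup v) → Unique (Vec.toList v)
lookup-injective⇒Unique []      inj = AllPairs.[]
lookup-injective⇒Unique {A} (x ∷ v) inj =
  fresh v (λ i eq → FinP.0≢1+n (inj zero (suc i) eq)) AllPairs.∷
  lookup-injective⇒Unique v (λ i j eq → suc-injective (inj (suc i) (suc j) eq))
  where
  fresh : ∀ {n} (w : Vec A n) → (∀ i → x ≢ lookup w i) → All (x ≢_) (Vec.toList w)
  fresh []      h = All.[]
  fresh (y ∷ w) h = h zero All.∷ fresh w (λ i → h (suc i))

-- Vectors with repeated entries stay in the list, since the filter that defines the group removes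
-- them. Deduplicating gives uniqueness at once.
allPerms : ∀ n → List (Perm n)
allPerms n = List.deduplicate _≟P_ (allVecs n)

∈-allPerms : ∀ {n} (p : Perm n) → p ∈ allPerms n
∈-allPerms p = ∈P.∈-deduplicate⁺ _≟P_ (∈-allVecs _ p)

index-injective : ∀ {A : Set} {x y : A} {xs} (p : x ∈ xs) (q : y ∈ xs) →
                  Any.index p ≡ Any.index q → x ≡ y
index-injective {xs = xs} p q eq = trans (AnyP.lookup-index p)
  (trans (cong (List.lookup xs) eq) (sym (AnyP.lookup-index q)))

funToFin-cong : ∀ {m n} {f g : Fin m → Fin n} → (∀ i → f i ≡ g i) → Fin.funToFin f ≡ Fin.funToFin g
funToFin-cong {zero}  eq = refl
funToFin-cong {suc m} eq = cong₂ combine (eq zero) (funToFin-cong (eq ∘ suc))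

fourBits : Bool → Bool → Bool → Bool → Fin 16
fourBits w x y z = combine (combine (bit w) (bit x)) (combine (bit y) (bit z))

bit-inj : ∀ {x y} → bit x ≡ bit y → x ≡ y
bit-inj eq = trans (sym (unbit-bit _)) (trans (cong unbit eq) (unbit-bit _))

fourBits-inj : ∀ {w x y z w′ x′ y′ z′} → fourBits w x y z ≡ fourBits w′ x′ y′ z′ →
           (w , x) ≡ (w′ , x′) × y ≡ y′ × z ≡ z′
fourBits-inj {w} {x} {y} {z} {w′} {x′} {y′} {z′} eq
  with eq₁ , eq₂ ← FinP.combine-injective (combine (bit w) (bit x)) (combine (bit y) (bit z))
                     (combine (bit w′) (bit x′)) (combine (bit y′) (bit z′)) eq
  with ew , ex ← FinP.combine-injective (bit w) (bit x) (bit w′) (bit x′) eq₁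
     | ey , ez ← FinP.combine-injective (bit y) (bit z) (bit y′) (bit z′) eq₂ =
  cong₂ _,_ (bit-inj ew) (bit-inj ex) , bit-inj ey , bit-inj ez

does-true : ∀ {A : Set} (d : Dec A) → does d ≡ true → A
does-true (yes a) _ = a

-- Cubic graphs with a code

data Path {M} (nb : Fin M → Fin 3 → Fin M) : Fin M → Fin M → Set where
  stay : ∀ {v} → Path nb v v
  hop   : ∀ {v w} i → Path nb (nb v i) w → Path nb v w

-- The graph has neighbour lists nb; the code consists of the bit vectors on the vertices
-- with even sum over every neighbourhood. The code contains the words `word φ`.
record CubicCode : Set where
  field
    M      : ℕ
    v₀     : Fin M
    nb     : Fin M → Fin 3 → Fin M
    nb-inj : ∀ v → Inj (nb v)
    nb-irr : ∀ v i → nb v i ≢ v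
    nb-sym : ∀ v i → ∃[ j ] nb (nb v i) j ≡ v

  -- The lists `nb v` fix a cyclic order at every vertex. One `b` has to serve all vertices, so that
  -- being a reflection is a property of `h` and not of a vertex.
  Oriented : Bool → (Fin M → Fin M) → Set
  Oriented b h = ∀ v → ∃[ k ] (∀ i → h (nb v i) ≡ nb (h v) (turn b k i))

  Sums : Bool → (Fin M → Bool) → Set
  Sums s x = ∀ v → Σ₃ (x ∘ nb v) ≡ s

  field
    path : ∀ v w → Path nb v w
    move : ∀ v w b k → ∃[ h ] (Inj h × Oriented b h × h v ≡ w ×
                               (∀ i → h (nb v i) ≡ nb w (turn b k i)))
    -- On a vertex and its neighbours the code is as large as parity allows; this makes the induced
    -- local group full.
    localWord : ∀ v e c → Σ₃ c ≡ false →
                ∃[ x ] (Sums false x × x v ≡ e × (∀ i → x (nb v i) ≡ c i))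
    dim       : ℕ
    word      : (Fin dim → Bool) → Fin M → Bool
    word-sums : ∀ φ → Sums false (word φ)
    tag       : (Fin dim → Bool) → Bool × Bool
    separated : ∀ φ ψ → (∀ v → word φ v ≡ word ψ v) → tag φ ≡ tag ψ → ∀ i → φ i ≡ ψ i

-- The doubled graph and its group

module FromCode (K : CubicCode) {L : PermGroup} {refl? tw : Bool}
                (local : LocalModel L refl? tw) where
  open CubicCode K
  open LocalModel local

  N′ : ℕ
  N′ = M ℕ.* 2

  enc : Fin M → Bool → Fin N′
  enc v e = combine v (bit e)

  vtx : Fin N′ → Fin M
  vtx p = proj₁ (remQuot {M} 2 p)

  lvl : Fin N′ → Bool
  lvl p = unbit (proj₂ (remQuot {M} 2 p))

  vtx-enc : ∀ v e → vtx (enc v e) ≡ v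
  vtx-enc v e = cong proj₁ (FinP.remQuot-combine v (bit e))

  lvl-enc : ∀ v e → lvl (enc v e) ≡ e
  lvl-enc v e = trans (cong (unbit ∘ proj₂) (FinP.remQuot-combine v (bit e))) (unbit-bit e)

  enc-dec : ∀ p → enc (vtx p) (lvl p) ≡ p
  enc-dec p = trans (cong (combine (vtx p)) (bit-unbit _)) (FinP.combine-remQuot {M} 2 p)

  Nb : Fin M → Fin M → Set
  Nb v w = ∃[ i ] nb v i ≡ w

  nb? : ∀ v w → Dec (Nb v w)
  nb? v w = any? (λ i → nb v i FinP.≟ w)

  adj′ : Fin N′ → Fin N′ → Bool
  adj′ p q = does (nb? (vtx p) (vtx q))

  adj⇒Nb : ∀ p q → adj′ p q ≡ true → Nb (vtx p) (vtx q)
  adj⇒Nb p q = does-true (nb? (vtx p) (vtx q))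

  Nb⇒adj : ∀ p q → Nb (vtx p) (vtx q) → adj′ p q ≡ true
  Nb⇒adj p q n = dec-true (nb? (vtx p) (vtx q)) n

  nb-adj : ∀ p q i → nb (vtx p) i ≡ vtx q → adj′ p q ≡ true
  nb-adj p q i eq = Nb⇒adj p q (i , eq)

  Nb-sym : ∀ {v w} → Nb v w → Nb w v
  Nb-sym {v} (i , refl) = nb-sym v i

  -- `g` covers `h` and swaps the copies of `v` when `c v` is set. For a twisted reflection `c` lies
  -- in the translate of the code by the all-one word, whose neighbourhood sums are odd because the
  -- valency is.
  record Acts (g : Perm N′) (h : Fin M → Fin M) (c : Fin M → Bool) (b : Bool) : Set where
    constructor acts
    field
      form    : ∀ v e → lookup g (enc v e) ≡ enc (h v) (e xor c v)
      inj     : Inj h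
      allowed : b ∧ refl? ≡ b
      orient  : Oriented b h
      sums    : Sums (b ∧ tw) c

  -- An element determines the vertex map and the word that it acts by. Reading them off the images
  -- of the `false` copies makes membership in the group decidable without a search for `h` and `c`.
  base : Perm N′ → Fin M → Fin M
  base g v = vtx (lookup g (enc v false))

  shift : Perm N′ → Fin M → Bool
  shift g v = lvl (lookup g (enc v false))

  Good : Perm N′ → Set
  Good g = ∃[ b ] Acts g (base g) (shift g) b

  acts? : ∀ g h c b → Dec (Acts g h c b)
  acts? g h c b = map′
    (λ { (p , q , r , s , t) → acts p q r s t })
    (λ { (acts p q r s t) → p , q , r , s , t })
    ((all? λ v → bool-all? λ e → lookup g (enc v e) FinP.≟ enc (h v) (e xor c v)) ×-dec
     (all? λ v → all? λ w → (h v FinP.≟ h w) →-dec (v FinP.≟ w)) ×-dec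
     (b ∧ refl? BoolP.≟ b) ×-dec
     (all? λ v → any? λ k → all? λ i → h (nb v i) FinP.≟ nb (h v) (turn b k i)) ×-dec
     (all? λ v → Σ₃ (c ∘ nb v) BoolP.≟ b ∧ tw))

  good? : ∀ g → Dec (Good g)
  good? g = bool-any? (acts? g (base g) (shift g))

  Acts⇒Good : ∀ {g h c b} → Acts g h c b → Good g
  Acts⇒Good {g} {h} {c} {b} (acts form inj allowed orient sums) = b , record
    { form = λ v e → trans (form v e) (cong₂ enc (base≡ v) (cong (e xor_) (shift≡ v)))
    ; inj = λ v w eq → inj v w (trans (base≡ v) (trans eq (sym (base≡ w))))
    ; allowed = allowed
    ; orient = λ v → let k , or = orient v in k , λ i →
        trans (sym (base≡ _)) (trans (or i) (cong (λ w → nb w (turn b k i)) (base≡ v)))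
    ; sums = λ v → trans (Σ₃-cong {base′ v} {c ∘ nb v} (λ i → sym (shift≡ (nb v i)))) (sums v) }
    where
    base≡ : ∀ v → h v ≡ base g v
    base≡ v = sym (trans (cong vtx (form v false)) (vtx-enc _ _))
    shift≡ : ∀ v → c v ≡ shift g v
    shift≡ v = sym (trans (cong lvl (form v false)) (lvl-enc _ _))
    base′ : Fin M → Fin 3 → Bool
    base′ v = shift g ∘ nb v

  G′ : List (Perm N′)
  G′ = filter good? (allPerms N′)

  G⇒Good : ∀ {g} → g ∈ G′ → Good g
  G⇒Good g∈ = proj₂ (∈P.∈-filter⁻ good? {xs = allPerms N′} g∈)

  Acts⇒G : ∀ {g h c b} → Acts g h c b → g ∈ G′
  Acts⇒G {g} a = ∈P.∈-filter⁺ good? (∈-allPerms g) (Acts⇒Good a)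

  perm : (Fin M → Fin M) → (Fin M → Bool) → Perm N′
  perm h c = tabulate (λ p → enc (h (vtx p)) (lvl p xor c (vtx p)))

  perm-form : ∀ h c v e → lookup (perm h c) (enc v e) ≡ enc (h v) (e xor c v)
  perm-form h c v e = trans (VecP.lookup∘tabulate _ (enc v e))
    (cong₂ (λ w f → enc (h w) (f xor c w)) (vtx-enc v e) (lvl-enc v e))

  form-at : ∀ {g h c b} → Acts g h c b → ∀ p →
            lookup g p ≡ enc (h (vtx p)) (lvl p xor c (vtx p))
  form-at {g} a p = trans (cong (lookup g) (sym (enc-dec p))) (Acts.form a (vtx p) (lvl p))

  vtx-image : ∀ {g h c b} → Acts g h c b → ∀ p → vtx (lookup g p) ≡ h (vtx p)
  vtx-image a p = trans (cong vtx (form-at a p)) (vtx-enc _ _)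

  lvl-image : ∀ {g h c b} → Acts g h c b → ∀ p → lvl (lookup g p) ≡ lvl p xor c (vtx p)
  lvl-image a p = trans (cong lvl (form-at a p)) (lvl-enc _ _)

  lookup-inj : ∀ {g h c b} → Acts g h c b → Inj (lookup g)
  lookup-inj {g} {h} {c} a p q eq = trans (sym (enc-dec p)) (trans (cong₂ enc same-vtx same-lvl) (enc-dec q))
    where
    same-vtx : vtx p ≡ vtx q
    same-vtx = Acts.inj a _ _ (trans (sym (vtx-image a p)) (trans (cong vtx eq) (vtx-image a q)))
    same-lvl : lvl p ≡ lvl q
    same-lvl = xor-cancelʳ (c (vtx p)) (trans (sym (lvl-image a p)) (trans (cong lvl eq)
      (trans (lvl-image a q) (cong (λ w → lvl q xor c w) (sym same-vtx)))))

  Nb-image : ∀ {b} h → Oriented b h → ∀ {v w} → Nb v w → Nb (h v) (h w)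
  Nb-image {b} h orient {v} (i , refl) = let k , or = orient v in turn b k i , sym (or i)

  Nb-preimage : ∀ {b} h → Oriented b h → Inj h → ∀ {v w} → Nb (h v) (h w) → Nb v w
  Nb-preimage {b} h orient inj {v} {w} (i , eq) =
    let k , or = orient v
        j , ji = turn-onto b k i
    in j , inj _ _ (trans (or j) (trans (cong (nb (h v)) ji) eq))

  acts-id : Acts idPerm (λ v → v) (λ _ → false) false
  acts-id = record
    { form = λ v e → trans (VecP.lookup-allFin _) (cong (enc v) (sym (BoolP.xor-identityʳ e)))
    ; inj = λ _ _ eq → eq ; allowed = refl
    ; orient = λ v → zero , λ i → refl ; sums = λ v → refl }

  ∧-xor : ∀ b b′ s → (b ∧ s) xor (b′ ∧ s) ≡ (b xor b′) ∧ s
  ∧-xor b b′ s = sym (BoolP.∧-distribʳ-xor s b b′)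

  -- The word `c′` pulled back along `h` has at `v` the sum that `c′` has at `h v`, because a turn
  -- only permutes the three summands; all other data add up in the bits.
  acts-· : ∀ {g h c b g′ h′ c′ b′} → Acts g h c b → Acts g′ h′ c′ b′ →
           Acts (g · g′) (h′ ∘ h) (λ v → c v xor c′ (h v)) (b xor b′)
  acts-· {g} {h} {c} {b} {g′} {h′} {c′} {b′} a a′ = record
    { form = λ v e → trans (VecP.lookup∘tabulate _ (enc v e)) (trans (cong (lookup g′) (A.form v e))
        (trans (A′.form _ _) (cong (enc _) (BoolP.xor-assoc e (c v) _))))
    ; inj = λ v w eq → A.inj v w (A′.inj _ _ eq)
    ; allowed = trans (sym (∧-xor b b′ refl?)) (cong₂ _xor_ A.allowed A′.allowed)
    ; orient = λ v →
        let k , or = A.orient v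
            k′ , or′ = A′.orient (h v)
            l , tt = turn-turn b k b′ k′
        in l , λ i → trans (cong h′ (or i)) (trans (or′ _) (cong (nb _) (tt i)))
    ; sums = λ v →
        let k , or = A.orient v
            c″ = c′ ∘ nb (h v)
        in trans (Σ₃-xor (c ∘ nb v) (c′ ∘ h ∘ nb v)) (trans (cong₂ _xor_ (A.sums v)
             (trans (Σ₃-cong {c′ ∘ h ∘ nb v} {c″ ∘ turn b k} (λ i → cong c′ (or i)))
               (trans (Σ₃-turn b k c″) (A′.sums (h v))))) (∧-xor b b′ tw)) }
    where
    module A = Acts a
    module A′ = Acts a′

  walk-from : ∀ {v w} → Path nb v w → ∀ p → vtx p ≡ v → ∀ q → vtx q ≡ w → 
              ∀ u → nb w zero ≡ u → Walk adj′ p q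
  -- For the empty path `p` and `q` may be the two copies of one vertex, which are not adjacent; so
  -- the walk goes out to a copy of `u` and back.
  walk-from {v} stay p refl q eq u r = step {w = enc u false}
    (nb-adj p (enc u false) zero (trans r (sym (vtx-enc u false))))
    (step (Nb⇒adj (enc u false) q (subst₂ Nb (sym (vtx-enc u false)) (sym eq) (Nb-sym (zero , r)))) here)
  walk-from (hop i π) p refl q eq u r = step {w = enc (nb (vtx p) i) false}
    (nb-adj p _ i (sym (vtx-enc _ _))) (walk-from π _ (vtx-enc _ _) q eq u r)

  module _ (p p′ q q′ : Fin N′) (pq : adj′ p q ≡ true) (pq′ : adj′ p′ q′ ≡ true) where
    arc-move : ∃[ g ] (g ∈ G′ × lookup g p ≡ p′ × lookup g q ≡ q′)
    arc-move = perm h x , Acts⇒G a , image p p′ h-p x-p , image q q′ h-q x-q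
      where
      n = adj⇒Nb p q pq
      n′ = adj⇒Nb p′ q′ pq′
      i = proj₁ n
      k = proj₁ (turn-to false i (proj₁ n′))
      mv = move (vtx p) (vtx p′) false k
      h = proj₁ mv
      t = lvl q xor lvl q′
      w = localWord (vtx p) (lvl p xor lvl p′) (evenWith i t) (evenWith-even i t)
      x = proj₁ w
      a : Acts (perm h x) h x false
      a = record { form = perm-form h x ; inj = proj₁ (proj₂ mv) ; allowed = refl
                 ; orient = proj₁ (proj₂ (proj₂ mv)) ; sums = proj₁ (proj₂ w) }
      image : ∀ r r′ → h (vtx r) ≡ vtx r′ → x (vtx r) ≡ lvl r xor lvl r′ → lookup (perm h x) r ≡ r′
      image r r′ hr xr = trans (form-at a r) (trans (cong₂ enc hr
        (trans (cong (lvl r xor_) xr) (xor-cancelˡ (lvl r) (lvl r′)))) (enc-dec r′))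
      h-p : h (vtx p) ≡ vtx p′
      h-p = proj₁ (proj₂ (proj₂ (proj₂ mv)))
      x-p : x (vtx p) ≡ lvl p xor lvl p′
      x-p = proj₁ (proj₂ (proj₂ w))
      h-q : h (vtx q) ≡ vtx q′
      h-q = trans (cong h (sym (proj₂ n))) (trans (proj₂ (proj₂ (proj₂ (proj₂ mv))) i)
        (trans (cong (nb (vtx p′)) (proj₂ (turn-to false i (proj₁ n′)))) (proj₂ n′)))
      x-q : x (vtx q) ≡ t
      x-q = trans (cong x (sym (proj₂ n))) (trans (proj₂ (proj₂ (proj₂ w)) i) (evenWith-at i t))

  module _ (p : Fin N′) where
    private
      v = vtx p

    ψ : Fin (deg L) → Fin N′
    ψ i = enc (nb v (proj₁ (pt i))) (proj₂ (pt i))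

    ψ-inj : ∀ i j → ψ i ≡ ψ j → i ≡ j
    ψ-inj i j eq = trans (sym (tp-pt i)) (trans (cong tp (cong₂ _,_
      (nb-inj v _ _ (trans (sym (vtx-enc _ _)) (trans (cong vtx eq) (vtx-enc _ _))))
      (trans (sym (lvl-enc _ _)) (trans (cong lvl eq) (lvl-enc _ _))))) (tp-pt j))

    ψ-adj : ∀ i → adj′ p (ψ i) ≡ true
    ψ-adj i = nb-adj p (ψ i) (proj₁ (pt i)) (sym (vtx-enc _ _))

    ψ-hits : ∀ q → adj′ p q ≡ true → ∃[ i ] ψ i ≡ q
    ψ-hits q pq = let j , eq = adj⇒Nb p q pq in
      tp (j , lvl q) , trans (cong (λ x → enc (nb v (proj₁ x)) (proj₂ x)) (pt-tp (j , lvl q)))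
                         (trans (cong (λ w → enc w (lvl q)) eq) (enc-dec q))

    ψ-image : ∀ {g h c b} → Acts g h c b → ∀ k → (∀ j → h (nb v j) ≡ nb v (turn b k j)) →
              ∀ (c′ : Fin 3 → Bool) → (∀ j → c (nb v j) ≡ c′ j) →
              ∀ σ → (∀ i → pt (lookup σ i) ≡ act b k c′ (pt i)) →
              ∀ i → lookup g (ψ i) ≡ ψ (lookup σ i)
    ψ-image a k hk c′ cc σ σ-acts i = trans (Acts.form a _ _)
      (trans (cong₂ enc (hk _) (cong (proj₂ (pt i) xor_) (cc _)))
        (cong (λ x → enc (nb v (proj₁ x)) (proj₂ x)) (sym (σ-acts i))))

    local-⊆ : ∀ g → g ∈ G′ → lookup g p ≡ p →
              ∃[ σ ] (σ ∈ elems L × (∀ i → lookup g (ψ i) ≡ ψ (lookup σ i)))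
    local-⊆ g g∈ fixes with b , a ← G⇒Good g∈ =
      let h-v = trans (sym (vtx-image a p)) (cong vtx fixes)
          k , or = Acts.orient a v
          c = shift g ∘ nb v
          σ , σ∈ , σ-acts = complete b k c (Acts.allowed a , Acts.sums a v)
      in σ , σ∈ , ψ-image a k (λ j → trans (or j) (cong (λ w → nb w (turn b k j)) h-v))
                    c (λ j → refl) σ σ-acts

    local-⊇ : ∀ σ → σ ∈ elems L →
              ∃[ g ] (g ∈ G′ × lookup g p ≡ p × (∀ i → lookup g (ψ i) ≡ ψ (lookup σ i)))
    local-⊇ σ σ∈ with b , k , c , (allowed , parity) , σ-acts ← sound σ σ∈ =
      perm h x , Acts⇒G a , trans (form-at a p) (trans (cong₂ enc h-v
        (trans (cong (lvl p xor_) x-v) (BoolP.xor-identityʳ (lvl p)))) (enc-dec p)) ,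
      ψ-image a k (proj₂ (proj₂ (proj₂ (proj₂ mv)))) c x-nb σ σ-acts
      where
      mv = move v v b k
      h = proj₁ mv
      h-v : h v ≡ v
      h-v = proj₁ (proj₂ (proj₂ (proj₂ mv)))
      s = b ∧ tw
      -- `localWord` yields even words only. Three copies of `s` sum to `s`, so `c⁺` is even; adding
      -- `s` at all vertices afterwards restores the sum `b ∧ tw`, and turns the value `s` at `v`
      -- into `false`.
      c⁺ : Fin 3 → Bool
      c⁺ i = s xor c i
      c⁺-even : Σ₃ c⁺ ≡ false
      c⁺-even = trans (Σ₃-xor (λ _ → s) c) (trans (cong₂ _xor_ (Σ₃-const s) parity) (BoolP.xor-same s))
      w = localWord v s c⁺ c⁺-even
      y = proj₁ w
      x : Fin M → Bool
      x u = s xor y u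
      x-v : x v ≡ false
      x-v = trans (cong (s xor_) (proj₁ (proj₂ (proj₂ w)))) (BoolP.xor-same s)
      x-nb : ∀ i → x (nb v i) ≡ c i
      x-nb i = trans (cong (s xor_) (proj₂ (proj₂ (proj₂ w)) i)) (xor-cancelˡ s (c i))
      a : Acts (perm h x) h x b
      a = record
        { form = perm-form h x ; inj = proj₁ (proj₂ mv) ; allowed = allowed
        ; orient = proj₁ (proj₂ (proj₂ mv))
        ; sums = λ u → trans (Σ₃-xor (λ _ → s) (y ∘ nb u))
            (trans (cong₂ _xor_ (Σ₃-const s) (proj₁ (proj₂ w) u)) (BoolP.xor-identityʳ s)) }

  pair : LocallyPair L
  pair = record
    { N = N′
    ; nonempty = ℕP.≤-<-trans z≤n (FinP.toℕ<n (enc v₀ false))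
    ; adj = adj′
    ; adj-sym = λ p q → does-⇔ (mk⇔ Nb-sym Nb-sym) (nb? (vtx p) (vtx q)) (nb? (vtx q) (vtx p))
    ; adj-irrefl = λ p → dec-false (nb? (vtx p) (vtx p)) (λ { (i , eq) → nb-irr (vtx p) i eq })
    ; connected = λ p q → walk-from (path (vtx p) (vtx q)) p refl q refl _ refl
    ; G = G′
    ; G-unique = UniqueP.filter⁺ good? (UniqueDP.deduplicate-! _≟P_ (allVecs N′))
    ; G-perm = λ g g∈ → lookup-injective⇒Unique g (lookup-inj (proj₂ (G⇒Good g∈)))
    ; G-aut = λ g g∈ p q → let b , a = G⇒Good g∈ in
        trans (cong₂ (λ v w → does (nb? v w)) (vtx-image a p) (vtx-image a q))
          (does-⇔ (mk⇔ (Nb-preimage {b} (base g) (Acts.orient a) (Acts.inj a))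
                       (Nb-image {b} (base g) (Acts.orient a)))
                  (nb? (base g (vtx p)) (base g (vtx q))) (nb? (vtx p) (vtx q)))
    ; G-id = Acts⇒G acts-id
    ; G-comp = λ g h g∈ h∈ → Acts⇒G (acts-· (proj₂ (G⇒Good g∈)) (proj₂ (G⇒Good h∈)))
    ; arcTrans = λ p q p′ q′ → arc-move p p′ q q′
    ; locally = λ p → record
        { φ = ψ p ; φ-inj = ψ-inj p
        ; φ-onto = λ q → mk⇔ (ψ-hits p q) (λ { (i , refl) → ψ-adj p i })
        ; restr⊆L = local-⊆ p ; L⊆restr = local-⊇ p } }

  module _ (p q : Fin N′) (pq : adj′ p q ≡ true) where
    private
      i = proj₁ (adj⇒Nb p q pq)
      nb-i : nb (vtx p) i ≡ vtx q
      nb-i = proj₂ (adj⇒Nb p q pq)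

      stab : List (Perm N′)
      stab = arcStab G′ p q

      -- The correcting word depends on the two values `e` and `f` only, so it can be removed again
      -- once these are known.
      fix : ∀ e f → ∃[ x ] (Sums false x × x (vtx p) ≡ e × (∀ j → x (nb (vtx p) j) ≡ evenWith i f j))
      fix e f = localWord (vtx p) e (evenWith i f) (evenWith-even i f)

      bits : Fin (2 ℕ.^ dim) → Fin dim → Bool
      bits n j = unbit (Fin.finToFun n j)

      bits-inj : ∀ n n′ → (∀ j → bits n j ≡ bits n′ j) → n ≡ n′
      bits-inj n n′ eq = trans (sym (FinP.funToFin-finToFin {dim} {2} n))
        (trans (funToFin-cong (λ j → trans (sym (bit-unbit _)) (trans (cong bit (eq j)) (bit-unbit _))))
               (FinP.funToFin-finToFin {dim} {2} n′))

      at-p at-q : Fin (2 ℕ.^ dim) → Bool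
      at-p n = word (bits n) (vtx p)
      at-q n = word (bits n) (vtx q)

      fixed : Fin (2 ℕ.^ dim) → Fin M → Bool
      fixed n u = word (bits n) u xor proj₁ (fix (at-p n) (at-q n)) u

      fixed-p : ∀ n → fixed n (vtx p) ≡ false
      fixed-p n = trans (cong (at-p n xor_) (proj₁ (proj₂ (proj₂ (fix (at-p n) (at-q n))))))
                        (BoolP.xor-same (at-p n))

      fixed-q : ∀ n → fixed n (vtx q) ≡ false
      fixed-q n = trans (cong (at-q n xor_) (trans (cong (proj₁ (fix (at-p n) (at-q n))) (sym nb-i))
                          (trans (proj₂ (proj₂ (proj₂ (fix (at-p n) (at-q n)))) i) (evenWith-at i (at-q n)))))
                        (BoolP.xor-same (at-q n))

      element : Fin (2 ℕ.^ dim) → Perm N′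
      element n = perm (λ u → u) (fixed n)

      element-acts : ∀ n → Acts (element n) (λ u → u) (fixed n) false
      element-acts n = record
        { form = perm-form (λ u → u) (fixed n) ; inj = λ _ _ eq → eq ; allowed = refl
        ; orient = λ v → zero , λ j → refl
        ; sums = λ v → trans (Σ₃-xor (word (bits n) ∘ nb v) (proj₁ (fix (at-p n) (at-q n)) ∘ nb v))
            (cong₂ _xor_ (word-sums (bits n) v) (proj₁ (proj₂ (fix (at-p n) (at-q n))) v)) }

      element-fixes : ∀ n r → fixed n (vtx r) ≡ false → lookup (element n) r ≡ r
      element-fixes n r eq = trans (form-at (element-acts n) r)
        (trans (cong (enc (vtx r)) (trans (cong (lvl r xor_) eq) (BoolP.xor-identityʳ (lvl r)))) (enc-dec r))

      element∈ : ∀ n → element n ∈ stab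
      element∈ n = ∈P.∈-filter⁺ _ (Acts⇒G (element-acts n))
        (element-fixes n p (fixed-p n) , element-fixes n q (fixed-q n))

      -- The four bits that `element n` forgets: two that `word` does not see, and the values at `p`
      -- and `q` that were cancelled.
      label : Fin (2 ℕ.^ dim) → Fin 16
      label n = fourBits (proj₁ (tag (bits n))) (proj₂ (tag (bits n))) (at-p n) (at-q n)

      slot : Fin (2 ℕ.^ dim) → Fin (length stab)
      slot n = Any.index (element∈ n)

      place : Fin (2 ℕ.^ dim) → Fin (16 ℕ.* length stab)
      place n = combine (label n) (slot n)

      place-inj : Inj place
      place-inj n n′ eq = bits-inj n n′ (separated (bits n) (bits n′) same-word (proj₁ same))
        where
        split : label n ≡ label n′ × slot n ≡ slot n′
        split = FinP.combine-injective (label n) (slot n) (label n′) (slot n′) eq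
        same : tag (bits n) ≡ tag (bits n′) × at-p n ≡ at-p n′ × at-q n ≡ at-q n′
        same = fourBits-inj (proj₁ split)
        same-fixed : ∀ u → fixed n u ≡ fixed n′ u
        same-fixed u = trans (sym (at n)) (trans (cong (λ g → lvl (lookup g (enc u false)))
          (index-injective (element∈ n) (element∈ n′) (proj₂ split))) (at n′))
          where
          at : ∀ m → lvl (lookup (element m) (enc u false)) ≡ fixed m u
          at m = trans (cong lvl (perm-form (λ u → u) (fixed m) u false)) (lvl-enc _ _)
        same-word : ∀ u → word (bits n) u ≡ word (bits n′) u
        same-word u = xor-cancelʳ (proj₁ (fix (at-p n) (at-q n)) u) (trans (same-fixed u)
          (cong₂ (λ e f → word (bits n′) u xor proj₁ (fix e f) u) (sym (proj₁ (proj₂ same))) (sym (proj₂ (proj₂ same)))))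

    -- Each of the `2 ^ dim` bit vectors yields a word, and this word, corrected to vanish at both
    -- ends of the arc, an element of the stabiliser. The element and the sixteen-valued `label`
    -- determine the bit vector.
    arcStab-bound : 2 ℕ.^ dim ≤ 16 ℕ.* length (arcStab G′ p q)
    arcStab-bound = injection-≤ place place-inj

-- Cubic graphs from arcs

pw : ∀ {d} (a : Fin d → Fin d) → Fin 3 → Fin d → Fin d
pw a zero             x = x
pw a (suc zero)       x = a x
pw a (suc (suc zero)) x = a (a x)

-- The points are the arcs of a cubic graph: a turns an arc around its initial vertex and
-- t reverses it. Bit vectors on the values of ξ give words of the code.
record ArcSystem : Set₁ where
  field
    d m   : ℕ
    a t   : Fin d → Fin d
    aaa   : ∀ x → a (a (a x)) ≡ x
    tt    : ∀ x → t (t x) ≡ x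
    root  : Fin d
    ind   : (P : Fin d → Set) → P root → (∀ x → P x → P (a x)) → (∀ x → P x → P (t x)) → ∀ x → P x
    auto  : ∀ x → ∃[ π ] (Inj π × (∀ y → π (a y) ≡ a (π y)) × (∀ y → π (t y) ≡ t (π y)) × π root ≡ x)
    mirror     : Fin d → Fin d
    mirror-inj : Inj mirror
    mirror-a   : ∀ x → mirror (a x) ≡ a (a (mirror x))
    mirror-t   : ∀ x → mirror (t x) ≡ t (mirror x)
    ξ      : Fin d → Fin m
    ξ-onto : ∀ i → ∃[ x ] ξ x ≡ i
    ξ-tat  : ∀ x → ξ (t (a (t x))) ≡ ξ x
    ξ-atat : ∀ x → ξ (a (t (a (t x)))) ≡ ξ (a x)
    -- These three inequalities exclude multiple edges and loops, and keep apart the values of `ξ`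
    -- on which local words are prescribed.
    ξ-a    : ∀ x → ξ (a x) ≢ ξ x
    ξ-t    : ∀ x → ξ (t x) ≢ ξ x
    ξ-at   : ∀ x → ξ (a (t x)) ≢ ξ x

turn-shift : ∀ b s i → turn false s (turn b zero i) ≡ turn b s i
turn-shift = toWitness {a? = bool-all? λ b → all? λ s → all? λ i →
  turn false s (turn b zero i) FinP.≟ turn b s i} _

xor-triangle : ∀ p q r → (p xor q) xor ((q xor r) xor (r xor p)) ≡ false
xor-triangle = toWitness {a? = bool-all? λ p → bool-all? λ q → bool-all? λ r →
  (p xor q) xor ((q xor r) xor (r xor p)) BoolP.≟ false} _

xor-cancelˡ′ : ∀ x {y z} → x xor y ≡ x xor z → y ≡ z
xor-cancelˡ′ x {y} {z} eq = trans (sym (xor-cancelˡ x y)) (trans (cong (x xor_) eq) (xor-cancelˡ x z))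

even-third : ∀ (c : Fin 3 → Bool) → Σ₃ c ≡ false → c (suc zero) xor c zero ≡ c (suc (suc zero))
even-third c even = close (c zero) (c (suc zero)) (c (suc (suc zero))) even
  where
  close : ∀ x y z → x xor (y xor z) ≡ false → y xor x ≡ z
  close = toWitness {a? = bool-all? λ x → bool-all? λ y → bool-all? λ z →
    (x xor (y xor z) BoolP.≟ false) →-dec (y xor x BoolP.≟ z)} _

module FromArcs (S : ArcSystem) where
  open ArcSystem S

  pow : Fin 3 → Fin d → Fin d
  pow = pw a

  pow-pow : ∀ i s x → pow i (pow s x) ≡ pow (turn false s i) x
  pow-pow zero             zero             x = refl
  pow-pow zero             (suc zero)       x = refl
  pow-pow zero             (suc (suc zero)) x = refl
  pow-pow (suc zero)       zero             x = refl
  pow-pow (suc zero)       (suc zero)       x = refl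
  pow-pow (suc zero)       (suc (suc zero)) x = aaa x
  pow-pow (suc (suc zero)) zero             x = refl
  pow-pow (suc (suc zero)) (suc zero)       x = aaa x
  pow-pow (suc (suc zero)) (suc (suc zero)) x = cong a (aaa x)

  -- Equivalent arcs have the same initial vertex, so the classes are the vertices of the cubic
  -- graph.
  _~_ : Fin d → Fin d → Set
  x ~ y = ∃[ s ] pow s x ≡ y

  ~-equivalence : Equivalence _~_
  ~-equivalence = record
    { ~-refl = λ x → zero , refl
    ; ~-sym = λ { (s , refl) → let i , eq = turn-onto false s zero in
                               i , trans (pow-pow i s _) (cong (λ j → pow j _) eq) }
    ; ~-trans = λ { (s , refl) (s′ , refl) → turn false s s′ , sym (pow-pow s′ s _) }
    ; ~-dec = λ x y → any? (λ s → pow s x FinP.≟ y) }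
  open Equivalence ~-equivalence
  open Quotient (quotient _~_ ~-equivalence) renaming (size to M)

  cls-~ : ∀ {x y} → cls x ≡ cls y → x ~ y
  cls-~ {x} {y} eq = ~-trans (~-sym (rep-cls x)) (subst (λ v → rep v ~ y) (sym eq) (rep-cls y))

  -- The representative serves as the first arc at `v`; another choice would only rotate the list of
  -- neighbours, as `nbr-cls` shows.
  nbr : Fin M → Fin 3 → Fin M
  nbr v i = cls (t (pow i (rep v)))

  cls-pow : ∀ s x → cls (pow s x) ≡ cls x
  cls-pow s x = sym (cls-cong (s , refl))

  nbr-cls : ∀ x → ∃[ s ] (∀ i → cls (t (pow i x)) ≡ nbr (cls x) (turn false s i))
  nbr-cls x = let s , eq = rep-cls x in
    s , λ i → cong (cls ∘ t) (trans (cong (pow i) (sym eq)) (pow-pow i s _))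

  -- As `turn b zero i` is `i` or `- i`, the map `π` commutes with `a` or inverts it.
  record ArcMap (b : Bool) (π : Fin d → Fin d) : Set where
    field
      inj   : Inj π
      π-pow : ∀ i x → π (pow i x) ≡ pow (turn b zero i) (π x)
      π-t   : ∀ x → π (t x) ≡ t (π x)

  commuting : ∀ {π} → Inj π → (∀ y → π (a y) ≡ a (π y)) → (∀ y → π (t y) ≡ t (π y)) → ArcMap false π
  commuting {π} inj π-a π-t = record { inj = inj ; π-t = π-t ; π-pow = λ
    { zero x → refl ; (suc zero) x → π-a x ; (suc (suc zero)) x → trans (π-a _) (cong a (π-a x)) } }

  -- The map taking `root` to `y`, after the inverse of the one taking `root` to `x`.
  translation : ∀ x y → ∃[ π ] (ArcMap false π × π x ≡ y)
  translation x y =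
    let π₁ , inj-π₁ , π₁-a , π₁-t , π₁-root = auto x
        π₂ , inj-π₂ , π₂-a , π₂-t , π₂-root = auto y
        inv = λ z → proj₁ (injective⇒onto π₁ inj-π₁ z)
        π₁-inv = λ z → proj₂ (injective⇒onto π₁ inj-π₁ z)
    in (λ z → π₂ (inv z)) ,
       commuting
         (λ z z′ eq → trans (sym (π₁-inv z)) (trans (cong π₁ (inj-π₂ _ _ eq)) (π₁-inv z′)))
         (λ z → trans (cong π₂ (inj-π₁ _ _ (trans (π₁-inv (a z))
                  (sym (trans (π₁-a (inv z)) (cong a (π₁-inv z))))))) (π₂-a _))
         (λ z → trans (cong π₂ (inj-π₁ _ _ (trans (π₁-inv (t z))
                  (sym (trans (π₁-t (inv z)) (cong t (π₁-inv z))))))) (π₂-t _)) ,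
       trans (cong π₂ (inj-π₁ _ _ (trans (π₁-inv x) (sym π₁-root)))) π₂-root

  arcMap : ∀ b x y → ∃[ π ] (ArcMap b π × π x ≡ y)
  arcMap false x y = translation x y
  arcMap true  x y = let π , A , eq = translation (mirror x) y in
    π ∘ mirror , record
      { inj = λ z z′ e → mirror-inj z z′ (ArcMap.inj A _ _ e)
      ; π-pow = λ { zero z → refl
                  ; (suc zero) z → trans (cong π (mirror-a z)) (ArcMap.π-pow A (suc (suc zero)) (mirror z))
                  ; (suc (suc zero)) z → trans (cong π (trans (mirror-a (a z)) (trans (cong (a ∘ a) (mirror-a z))
                      (aaa (a (mirror z)))))) (ArcMap.π-pow A (suc zero) (mirror z)) }
      ; π-t = λ z → trans (cong π (mirror-t z)) (ArcMap.π-t A (mirror z)) } , eq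

  module Induced {b π} (A : ArcMap b π) where
    open ArcMap A

    h : Fin M → Fin M
    h v = cls (π (rep v))

    h-inj : Inj h
    h-inj v w eq = trans (sym (cls-rep v)) (trans (cls-cong (s′ , inj _ _ same)) (cls-rep w))
      where
      s = proj₁ (cls-~ eq)
      s′ = proj₁ (turn-onto b zero s)
      same : π (pow s′ (rep v)) ≡ π (rep w)
      same = trans (π-pow s′ (rep v)) (trans (cong (λ j → pow j (π (rep v))) (proj₂ (turn-onto b zero s)))
               (proj₂ (cls-~ eq)))

    h-cls : ∀ x → h (cls x) ≡ cls (π x)
    h-cls x = let s , eq = rep-cls x in
      cls-cong (turn b zero s , trans (sym (π-pow s _)) (cong π eq))

    h-nbr : ∀ v i → h (nbr v i) ≡ cls (t (pow (turn b zero i) (π (rep v))))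
    h-nbr v i = trans (h-cls _) (cong cls (trans (π-t _) (cong t (π-pow i (rep v)))))

    h-orient : ∀ v → ∃[ k ] (∀ i → h (nbr v i) ≡ nbr (h v) (turn b k i))
    h-orient v = let s , eq = nbr-cls (π (rep v)) in
      s , λ i → trans (h-nbr v i) (trans (eq (turn b zero i)) (cong (nbr (h v)) (turn-shift b s i)))

  -- Induced by the arc map that takes the first arc at `v` to the `k`-th arc at `w`.
  moving : ∀ v w b k → ∃[ h ] (Inj h × (∀ u → ∃[ l ] (∀ i → h (nbr u i) ≡ nbr (h u) (turn b l i))) ×
           h v ≡ w × (∀ i → h (nbr v i) ≡ nbr w (turn b k i)))
  moving v w b k = h , h-inj , h-orient
    , trans (cong cls π-v) (trans (cls-pow k (rep w)) (cls-rep w))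
    , λ i → trans (h-nbr v i) (cong (cls ∘ t) (trans (cong (pow (turn b zero i)) π-v)
              (trans (pow-pow _ k (rep w)) (cong (λ j → pow j (rep w)) (turn-shift b k i)))))
    where
    πA = arcMap b (rep v) (pow k (rep w))
    π-v = proj₂ (proj₂ πA)
    open Induced (proj₁ (proj₂ πA))

  -- With `ξ-ata` this says that `ξ (t x)` and `ξ (a (t x))` depend only on the initial vertex of
  -- `x`; hence the words are functions on vertices.
  ξ-ta : ∀ y → ξ (t (a y)) ≡ ξ (t y)
  ξ-ta y = trans (cong (ξ ∘ t ∘ a) (sym (tt y))) (ξ-tat (t y))

  ξ-ata : ∀ y → ξ (a (t (a y))) ≡ ξ (a (t y))
  ξ-ata y = trans (cong (ξ ∘ a ∘ t ∘ a) (sym (tt y))) (ξ-atat (t y))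

  ξ-t-pow : ∀ i y → ξ (t (pow i y)) ≡ ξ (t y)
  ξ-t-pow zero             y = refl
  ξ-t-pow (suc zero)       y = ξ-ta y
  ξ-t-pow (suc (suc zero)) y = trans (ξ-ta (a y)) (ξ-ta y)

  ξ-at-pow : ∀ i y → ξ (a (t (pow i y))) ≡ ξ (a (t y))
  ξ-at-pow zero             y = refl
  ξ-at-pow (suc zero)       y = ξ-ata y
  ξ-at-pow (suc (suc zero)) y = trans (ξ-ata (a y)) (ξ-ata y)

  ξ-aa : ∀ x → ξ (a (a x)) ≢ ξ x
  ξ-aa x eq = ξ-a (a (a x)) (trans (cong ξ (aaa x)) (sym eq))

  ξ-pow-inj : ∀ i j x → ξ (pow i x) ≡ ξ (pow j x) → i ≡ j
  ξ-pow-inj zero             zero             x eq = refl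
  ξ-pow-inj zero             (suc zero)       x eq = contradiction (sym eq) (ξ-a x)
  ξ-pow-inj zero             (suc (suc zero)) x eq = contradiction (sym eq) (ξ-aa x)
  ξ-pow-inj (suc zero)       zero             x eq = contradiction eq (ξ-a x)
  ξ-pow-inj (suc zero)       (suc zero)       x eq = refl
  ξ-pow-inj (suc zero)       (suc (suc zero)) x eq = contradiction (sym eq) (ξ-a (a x))
  ξ-pow-inj (suc (suc zero)) zero             x eq = contradiction eq (ξ-aa x)
  ξ-pow-inj (suc (suc zero)) (suc zero)       x eq = contradiction eq (ξ-a (a x))
  ξ-pow-inj (suc (suc zero)) (suc (suc zero)) x eq = refl

  t-inj : Inj t
  t-inj x y eq = trans (sym (tt x)) (trans (cong t eq) (tt y))

  -- If two neighbours of `v` coincide, the reversed arcs lie in one class. They have the same `ξ`,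
  -- and `ξ` separates the three arcs of a class, so they are equal.
  nbr-inj : ∀ v → Inj (nbr v)
  nbr-inj v i j eq = ξ-pow-inj i j x (cong ξ (t-inj _ _ (trans (cong (λ k → pow k y) (sym s≡0)) s-eq)))
    where
    x = rep v
    y = t (pow i x)
    s = proj₁ (cls-~ eq)
    s-eq : pow s y ≡ t (pow j x)
    s-eq = proj₂ (cls-~ eq)
    s≡0 : s ≡ zero
    s≡0 = ξ-pow-inj s zero y (trans (cong ξ s-eq) (trans (ξ-t-pow j x) (sym (ξ-t-pow i x))))

  not-own-reverse : ∀ s y → pow s (t y) ≢ y
  not-own-reverse zero             y eq = ξ-t y (cong ξ eq)
  not-own-reverse (suc zero)       y eq = ξ-at y (cong ξ eq)
  -- Here `a y` is `t y`, so `ξ (t y)`, which equals `ξ (t (a y))`, is `ξ (t (t y))`, that is `ξ y`.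
  not-own-reverse (suc (suc zero)) y eq = ξ-t y (trans (sym (ξ-ta y))
    (trans (cong (ξ ∘ t) (trans (cong a (sym eq)) (aaa (t y)))) (cong ξ (tt y))))

  nbr-irr : ∀ v i → nbr v i ≢ v
  nbr-irr v i eq =
    let s , s-eq = cls-~ (trans eq (sym (cls-rep v)))
    in not-own-reverse (turn false s i) (pow i (rep v))
         (trans (sym (pow-pow i s _)) (cong (pow i) s-eq))

  nbr-t : ∀ x → ∃[ j ] nbr (cls x) j ≡ cls (t x)
  nbr-t x = let s , eq = nbr-cls x in turn false s zero , sym (eq zero)

  nbr-sym : ∀ v i → ∃[ j ] nbr (nbr v i) j ≡ v
  nbr-sym v i = let j , eq = nbr-t (t (pow i (rep v))) in
    j , trans eq (trans (cong cls (tt _)) (trans (cls-pow i (rep v)) (cls-rep v)))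

  _++ᵖ_ : ∀ {u v w} → Path nbr u v → Path nbr v w → Path nbr u w
  stay   ++ᵖ q = q
  hop i p ++ᵖ q = hop i (p ++ᵖ q)

  reverse : ∀ {u v} → Path nbr u v → Path nbr v u
  reverse stay = stay
  reverse (hop {v} i p) = let j , eq = nbr-sym v i in
    reverse p ++ᵖ hop j (subst (λ w → Path nbr w v) (sym eq) stay)

  from-root : ∀ x → Path nbr (cls root) (cls x)
  from-root = ind (λ x → Path nbr (cls root) (cls x)) stay
    (λ x p → subst (Path nbr (cls root)) (sym (cls-pow (suc zero) x)) p)
    (λ x p → let j , eq = nbr-t x in
      p ++ᵖ hop j (subst (λ w → Path nbr w (cls (t x))) (sym eq) stay))

  connection : ∀ v w → Path nbr v w
  connection v w = subst₂ (Path nbr) (cls-rep v) (cls-rep w)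
    (reverse (from-root (rep v)) ++ᵖ from-root (rep w))

  f : (Fin m → Bool) → Fin d → Bool
  f φ x = φ (ξ (t x)) xor φ (ξ (a (t x)))

  f-pow : ∀ φ i x → f φ (pow i x) ≡ f φ x
  f-pow φ i x = cong₂ (λ p q → φ p xor φ q) (ξ-t-pow i x) (ξ-at-pow i x)

  f-t : ∀ φ x → f φ (t x) ≡ φ (ξ x) xor φ (ξ (a x))
  f-t φ x = cong (λ y → φ (ξ y) xor φ (ξ (a y))) (tt x)

  wd : (Fin m → Bool) → Fin M → Bool
  wd φ v = f φ (rep v)

  wd-cls : ∀ φ x → wd φ (cls x) ≡ f φ x
  wd-cls φ x = let s , eq = rep-cls x in trans (sym (f-pow φ s (rep (cls x)))) (cong (f φ) eq)

  wd-nbr : ∀ φ v i → wd φ (nbr v i) ≡ φ (ξ (pow i (rep v))) xor φ (ξ (a (pow i (rep v))))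
  wd-nbr φ v i = trans (wd-cls φ _) (f-t φ _)

  wd-even : ∀ φ v → Σ₃ (wd φ ∘ nbr v) ≡ false
  wd-even φ v = trans (Σ₃-cong {wd φ ∘ nbr v} (wd-nbr φ v))
    (trans (cong (λ y → (p xor q) xor ((q xor r) xor (r xor φ (ξ y)))) (aaa x)) (xor-triangle p q r))
    where
    x = rep v
    p = φ (ξ x)
    q = φ (ξ (a x))
    r = φ (ξ (a (a x)))

  module _ (v : Fin M) (e : Bool) (c : Fin 3 → Bool) (even : Σ₃ c ≡ false) where
    private
      x = rep v

      choose : ∀ (i : Fin m) → Dec (i ≡ ξ (t x)) → Dec (i ≡ ξ x) → Dec (i ≡ ξ (a (a x))) → Bool
      choose i (yes _) _       _       = e
      choose i (no _)  (yes _) _       = c zero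
      choose i (no _)  (no _)  (yes _) = c (suc zero)
      choose i (no _)  (no _)  (no _)  = false

      -- Only three values of `ξ` carry bits. As `φ` vanishes at `ξ (a x)` and `ξ (a (t x))`, the
      -- word is `e` at `v` and `c zero`, `c (suc zero)` and their sum at the neighbours; evenness
      -- makes this sum the third entry.
      φ : Fin m → Bool
      φ i = choose i (i FinP.≟ ξ (t x)) (i FinP.≟ ξ x) (i FinP.≟ ξ (a (a x)))

      φ-tx : φ (ξ (t x)) ≡ e
      φ-tx with ξ (t x) FinP.≟ ξ (t x)
      ... | yes _ = refl
      ... | no ne = contradiction refl ne

      φ-x : φ (ξ x) ≡ c zero
      φ-x with ξ x FinP.≟ ξ (t x) | ξ x FinP.≟ ξ x
      ... | yes eq | _     = contradiction (sym eq) (ξ-t x)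
      ... | no _   | yes _ = refl
      ... | no _   | no ne = contradiction refl ne

      φ-aax : φ (ξ (a (a x))) ≡ c (suc zero)
      φ-aax with ξ (a (a x)) FinP.≟ ξ (t x) | ξ (a (a x)) FinP.≟ ξ x | ξ (a (a x)) FinP.≟ ξ (a (a x))
      ... | yes eq | _      | _     = contradiction (trans (ξ-t-pow (suc (suc zero)) x) (sym eq)) (ξ-t _)
      ... | no _   | yes eq | _     = contradiction eq (ξ-aa x)
      ... | no _   | no _   | yes _ = refl
      ... | no _   | no _   | no ne = contradiction refl ne

      φ-other : ∀ i → i ≢ ξ (t x) → i ≢ ξ x → i ≢ ξ (a (a x)) → φ i ≡ false
      φ-other i n₁ n₂ n₃ with i FinP.≟ ξ (t x) | i FinP.≟ ξ x | i FinP.≟ ξ (a (a x))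
      ... | yes eq | _      | _      = contradiction eq n₁
      ... | no _   | yes eq | _      = contradiction eq n₂
      ... | no _   | no _   | yes eq = contradiction eq n₃
      ... | no _   | no _   | no _   = refl

      φ-ax : φ (ξ (a x)) ≡ false
      φ-ax = φ-other _ (λ eq → ξ-t (a x) (trans (ξ-ta x) (sym eq))) (ξ-a x)
                       (λ eq → ξ-a (a x) (sym eq))

      φ-atx : φ (ξ (a (t x))) ≡ false
      φ-atx = φ-other _ (ξ-a (t x)) (ξ-at x)
                        (λ eq → ξ-at (a (a x)) (trans (ξ-at-pow (suc (suc zero)) x) eq))

      at-nbr : ∀ i → φ (ξ (pow i x)) xor φ (ξ (a (pow i x))) ≡ c i
      at-nbr zero             = trans (cong₂ _xor_ φ-x φ-ax) (BoolP.xor-identityʳ _)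
      at-nbr (suc zero)       = cong₂ _xor_ φ-ax φ-aax
      at-nbr (suc (suc zero)) = trans (cong₂ _xor_ φ-aax (trans (cong (φ ∘ ξ) (aaa x)) φ-x)) (even-third c even)

    prescribed : ∃[ y ] ((∀ u → Σ₃ (y ∘ nbr u) ≡ false) × y v ≡ e × (∀ i → y (nbr v i) ≡ c i))
    prescribed = wd φ , wd-even φ , trans (cong₂ _xor_ φ-tx φ-atx) (BoolP.xor-identityʳ e)
               , λ i → trans (wd-nbr φ v i) (at-nbr i)

  -- The word gives the sum of the bits at `ξ x` and `ξ (a x)`, so agreement spreads along `a`. For
  -- `t` the bit at `ξ (t x)` is carried along: `a` leaves it alone and `t` exchanges it with the
  -- first. The tags start the induction.
  separation : ∀ φ ψ → (∀ v → wd φ v ≡ wd ψ v) →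
               (φ (ξ root) , φ (ξ (t root))) ≡ (ψ (ξ root) , ψ (ξ (t root))) → ∀ i → φ i ≡ ψ i
  separation φ ψ same tags i = let x , eq = ξ-onto i in
    subst (λ j → φ j ≡ ψ j) eq (proj₁ (agree x))
    where
    same-f : ∀ x → f φ x ≡ f ψ x
    same-f x = trans (sym (wd-cls φ x)) (trans (same (cls x)) (wd-cls ψ x))
    Agree : Fin d → Set
    Agree x = φ (ξ x) ≡ ψ (ξ x) × φ (ξ (t x)) ≡ ψ (ξ (t x))
    agree : ∀ x → Agree x
    agree = ind Agree (cong proj₁ tags , cong proj₂ tags)
      (λ { x (p , q) →
           xor-cancelˡ′ (φ (ξ x)) (trans (sym (f-t φ x)) (trans (same-f (t x))
             (trans (f-t ψ x) (cong (_xor ψ (ξ (a x))) (sym p)))))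
         , trans (cong φ (ξ-ta x)) (trans q (cong ψ (sym (ξ-ta x)))) })
      (λ { x (p , q) → q , trans (cong (φ ∘ ξ) (tt x)) (trans p (cong (ψ ∘ ξ) (sym (tt x)))) })

  code : CubicCode
  code = record
    { M = M ; v₀ = cls root ; nb = nbr ; nb-inj = nbr-inj ; nb-irr = nbr-irr ; nb-sym = nbr-sym
    ; path = connection ; move = moving ; localWord = prescribed
    ; dim = m ; word = wd ; word-sums = wd-even
    ; tag = λ φ → φ (ξ root) , φ (ξ (t root)) ; separated = separation }

  M≤d : M ≤ d
  M≤d = injection-≤ rep (λ v w eq → trans (sym (cls-rep v)) (trans (cong cls eq) (cls-rep w)))

  d≤3M : d ≤ M ℕ.* 3
  d≤3M = injection-≤ (λ x → combine (cls x) (proj₁ (rep-cls x))) λ x y eq →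
    let same-cls , same-pow = FinP.combine-injective (cls x) _ (cls y) _ eq
    in trans (sym (proj₂ (rep-cls x))) (trans (cong₂ (λ v s → pow s (rep v)) same-cls same-pow)
         (proj₂ (rep-cls y)))

-- Arcs from permutation groups

-- Conjugation by `F` inverts `A` and fixes `T`; it becomes the mirror. One witness suffices in each
-- of the last three fields, because every group element maps onto all points.
record PermSystem (Q : ℕ) : Set where
  field
    A T F : Fin Q → Fin Q
    AAA : ∀ x → A (A (A x)) ≡ x
    TT  : ∀ x → T (T x) ≡ x
    FF  : ∀ x → F (F x) ≡ x
    FA  : ∀ x → F (A x) ≡ A (A (F x))
    FT  : ∀ x → F (T x) ≡ T (F x)
    P   : Fin Q → Bool
    P-tat  : ∀ x → P (T (A (T x))) ≡ P x
    P-atat : ∀ x → P (A (T (A (T x)))) ≡ P (A x)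
    P-a  : ∃[ w ] P (A w) ≢ P w
    P-t  : ∃[ w ] P (T w) ≢ P w
    P-at : ∃[ w ] P (A (T w)) ≢ P w

-- The arcs are the elements k of the group generated by A and T, a and t are left
-- multiplication by A and T, and ξ k is the coset of k modulo the stabiliser of P.
module FromPerms {Q} (S : PermSystem Q) where
  open PermSystem S

  X : Set
  X = Perm Q

  Reachable : X → Set
  Reachable = Reach idPerm (Vec.map A) (Vec.map T)

  -- Bounds the number of vectors, as the orbit search requires.
  toCode : X → Fin (Q ℕ.^ Q)
  toCode k = Fin.funToFin (lookup k)

  toCode-inj : Inj toCode
  toCode-inj k k′ eq = lookup-ext λ i → trans (sym (FinP.finToFun-funToFin (lookup k) i))
    (trans (cong (λ c → Fin.finToFun c i) eq) (FinP.finToFun-funToFin (lookup k′) i))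

  open Orbit (orbit idPerm (Vec.map A) (Vec.map T) toCode toCode-inj) renaming (size to d)

  a t : Fin d → Fin d
  a x = index (viaA (reach x))
  t x = index (viaT (reach x))

  el-a : ∀ x → el (a x) ≡ Vec.map A (el x)
  el-a x = el-index (viaA (reach x))

  el-t : ∀ x → el (t x) ≡ Vec.map T (el x)
  el-t x = el-index (viaT (reach x))

  at-a : ∀ x i → lookup (el (a x)) i ≡ A (lookup (el x) i)
  at-a x i = trans (cong (λ k → lookup k i) (el-a x)) (VecP.lookup-map i A (el x))

  at-t : ∀ x i → lookup (el (t x)) i ≡ T (lookup (el x) i)
  at-t x i = trans (cong (λ k → lookup k i) (el-t x)) (VecP.lookup-map i T (el x))

  el-ext : ∀ {x y} → (∀ i → lookup (el x) i ≡ lookup (el y) i) → x ≡ y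
  el-ext eq = el-inj _ _ (lookup-ext eq)

  top : Fin d
  top = index start

  el-top : el top ≡ idPerm
  el-top = el-index start

  induct : (R : Fin d → Set) → R top → (∀ x → R x → R (a x)) → (∀ x → R x → R (t x)) → ∀ x → R x
  induct R r ra rt x = go (reach x) refl
    where
    go : ∀ {k} → Reachable k → ∀ {x} → el x ≡ k → R x
    go start    eq = subst R (el-inj _ _ (trans el-top (sym eq))) r
    go (viaA p) eq = subst R
      (el-inj _ _ (trans (el-a _) (trans (cong (Vec.map A) (el-index p)) (sym eq)))) (ra _ (go p (el-index p)))
    go (viaT p) eq = subst R
      (el-inj _ _ (trans (el-t _) (trans (cong (Vec.map T) (el-index p)) (sym eq)))) (rt _ (go p (el-index p)))

  lookup-onto : ∀ {k} → Reachable k → ∀ j → ∃[ i ] lookup k i ≡ j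
  lookup-onto start j = j , VecP.lookup-allFin j
  lookup-onto (viaA {k} p) j = let i , eq = lookup-onto p (A (A j)) in
    i , trans (VecP.lookup-map i A k) (trans (cong A eq) (AAA j))
  lookup-onto (viaT {k} p) j = let i , eq = lookup-onto p (T j) in
    i , trans (VecP.lookup-map i T k) (trans (cong T eq) (TT j))

  lookup-· : ∀ (h k : X) i → lookup (h · k) i ≡ lookup k (lookup h i)
  lookup-· h k i = VecP.lookup∘tabulate _ i

  ·-map : ∀ (f : Fin Q → Fin Q) (h k : X) → Vec.map f (h · k) ≡ h · Vec.map f k
  ·-map f h k = lookup-ext λ i → trans (VecP.lookup-map i f (h · k)) (trans (cong f (lookup-· h k i))
    (sym (trans (lookup-· h (Vec.map f k) i) (VecP.lookup-map _ f k))))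

  ·-id : ∀ (h : X) → h · idPerm ≡ h
  ·-id h = lookup-ext λ i → trans (lookup-· h idPerm i) (VecP.lookup-allFin _)

  reach-· : ∀ {h k} → Reachable h → Reachable k → Reachable (h · k)
  reach-· {h} p start = subst Reachable (sym (·-id h)) p
  reach-· {h} p (viaA {k} q) = subst Reachable (·-map A h k) (viaA (reach-· p q))
  reach-· {h} p (viaT {k} q) = subst Reachable (·-map T h k) (viaT (reach-· p q))

  -- The factor `el x` is applied first, whereas `a` and `t` compose with `A` and `T` last; so
  -- translations commute with both.
  translate : Fin d → Fin d → Fin d
  translate x y = index (reach-· (reach x) (reach y))

  at-translate : ∀ x y i → lookup (el (translate x y)) i ≡ lookup (el y) (lookup (el x) i)
  at-translate x y i = trans (cong (λ k → lookup k i) (el-index (reach-· (reach x) (reach y))))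
                             (lookup-· (el x) (el y) i)

  translate-inj : ∀ x → Inj (translate x)
  translate-inj x y z eq = el-ext λ j → let i , ij = lookup-onto (reach x) j in
    subst (λ j → lookup (el y) j ≡ lookup (el z) j) ij
      (trans (sym (at-translate x y i)) (trans (cong (λ w → lookup (el w) i) eq) (at-translate x z i)))

  conj : X → X
  conj k = tabulate (λ i → F (lookup k (F i)))

  lookup-conj : ∀ k i → lookup (conj k) i ≡ F (lookup k (F i))
  lookup-conj k i = VecP.lookup∘tabulate _ i

  reach-conj : ∀ {k} → Reachable k → Reachable (conj k)
  reach-conj start = subst Reachable (sym (lookup-ext λ i → trans (lookup-conj idPerm i)
    (trans (cong F (VecP.lookup-allFin _)) (trans (FF i) (sym (VecP.lookup-allFin i)))))) start
  reach-conj (viaA {k} p) = subst Reachable (sym (lookup-ext λ i → trans (lookup-conj (Vec.map A k) i)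
    (trans (cong F (VecP.lookup-map _ A k)) (trans (FA _) (trans (cong (A ∘ A) (sym (lookup-conj k i)))
      (sym (trans (VecP.lookup-map i A (Vec.map A (conj k))) (cong A (VecP.lookup-map i A (conj k))))))))))
    (viaA (viaA (reach-conj p)))
  reach-conj (viaT {k} p) = subst Reachable (sym (lookup-ext λ i → trans (lookup-conj (Vec.map T k) i)
    (trans (cong F (VecP.lookup-map _ T k)) (trans (FT _) (trans (cong T (sym (lookup-conj k i)))
      (sym (VecP.lookup-map i T (conj k))))))))
    (viaT (reach-conj p))

  mirrored : Fin d → Fin d
  mirrored x = index (reach-conj (reach x))

  at-mirrored : ∀ x i → lookup (el (mirrored x)) i ≡ F (lookup (el x) (F i))
  at-mirrored x i = trans (cong (λ k → lookup k i) (el-index (reach-conj (reach x)))) (lookup-conj (el x) i)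

  F-inj : Inj F
  F-inj x y eq = trans (sym (FF x)) (trans (cong F eq) (FF y))

  mirrored-inj : Inj mirrored
  mirrored-inj x y eq = el-ext λ j → subst (λ j → lookup (el x) j ≡ lookup (el y) j) (FF j)
    (F-inj _ _ (trans (sym (at-mirrored x (F j)))
      (trans (cong (λ w → lookup (el w) (F j)) eq) (at-mirrored y (F j)))))

  _≈_ : Fin d → Fin d → Set
  x ≈ y = Vec.map P (el x) ≡ Vec.map P (el y)

  ≈-equivalence : Equivalence _≈_
  ≈-equivalence = record { ~-refl = λ x → refl ; ~-sym = sym ; ~-trans = trans
    ; ~-dec = λ x y → VecP.≡-dec BoolP._≟_ (Vec.map P (el x)) (Vec.map P (el y)) }

  open Quotient (quotient _≈_ ≈-equivalence)
    renaming (size to m; cls to ξ; cls-rep to ξ-rep; rep-cls to rep-ξ; cls-cong to ξ-cong)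

  ξ-intro : ∀ x y → (∀ i → P (lookup (el x) i) ≡ P (lookup (el y) i)) → ξ x ≡ ξ y
  ξ-intro x y eq = ξ-cong (lookup-ext λ i →
    trans (VecP.lookup-map i P (el x)) (trans (eq i) (sym (VecP.lookup-map i P (el y)))))

  ξ-elim : ∀ x y → ξ x ≡ ξ y → ∀ i → P (lookup (el x) i) ≡ P (lookup (el y) i)
  ξ-elim x y eq i = trans (sym (VecP.lookup-map i P (el x)))
    (trans (cong (λ v → lookup v i) (trans (sym (rep-ξ x))
      (subst (λ c → rep c ≈ y) (sym eq) (rep-ξ y)))) (VecP.lookup-map i P (el y)))

  -- The point `w` is the image of some `i` under `el x`, and at this `i` the two characteristic
  -- vectors differ.
  ξ-distinct : ∀ (f : Fin Q → Fin Q) (g : Fin d → Fin d) → (∀ x i → lookup (el (g x)) i ≡ f (lookup (el x) i)) →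
               ∃[ w ] P (f w) ≢ P w → ∀ x → ξ (g x) ≢ ξ x
  ξ-distinct f g at-g (w , differ) x eq = let i , iw = lookup-onto (reach x) w in
    differ (subst (λ w → P (f w) ≡ P w) iw
      (trans (cong P (sym (at-g x i))) (ξ-elim (g x) x eq i)))

  arcSystem : ArcSystem
  arcSystem = record
    { d = d ; m = m ; a = a ; t = t
    ; aaa = λ x → el-ext λ i → trans (at-a _ i) (trans (cong A (trans (at-a _ i) (cong A (at-a x i)))) (AAA _))
    ; tt = λ x → el-ext λ i → trans (at-t _ i) (trans (cong T (at-t x i)) (TT _))
    ; root = top ; ind = induct
    ; auto = λ x → translate x , translate-inj x
        , (λ y → el-ext λ i → trans (at-translate x (a y) i) (trans (at-a y _)
             (sym (trans (at-a _ i) (cong A (at-translate x y i))))))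
        , (λ y → el-ext λ i → trans (at-translate x (t y) i) (trans (at-t y _)
             (sym (trans (at-t _ i) (cong T (at-translate x y i))))))
        , el-ext λ i → trans (at-translate x top i)
            (trans (cong (λ k → lookup k (lookup (el x) i)) el-top) (VecP.lookup-allFin _))
    ; mirror = mirrored ; mirror-inj = mirrored-inj
    ; mirror-a = λ x → el-ext λ i → trans (at-mirrored (a x) i) (trans (cong F (at-a x _)) (trans (FA _)
        (sym (trans (at-a _ i) (cong A (trans (at-a _ i) (cong A (at-mirrored x i))))))))
    ; mirror-t = λ x → el-ext λ i → trans (at-mirrored (t x) i) (trans (cong F (at-t x _)) (trans (FT _)
        (sym (trans (at-t _ i) (cong T (at-mirrored x i))))))
    ; ξ = ξ ; ξ-onto = λ c → rep c , ξ-rep c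
    ; ξ-tat = λ x → ξ-intro _ x λ i → trans (cong P (at-tat x i)) (P-tat _)
    ; ξ-atat = λ x → ξ-intro _ (a x) λ i → trans (cong P (trans (at-a _ i) (cong A (at-tat x i))))
        (trans (P-atat _) (cong P (sym (at-a x i))))
    ; ξ-a = ξ-distinct A a at-a P-a
    ; ξ-t = ξ-distinct T t at-t P-t
    ; ξ-at = ξ-distinct (A ∘ T) (a ∘ t) (λ x i → trans (at-a _ i) (cong A (at-t x i))) P-at }
    where
    at-tat : ∀ x i → lookup (el (t (a (t x)))) i ≡ T (A (T (lookup (el x) i)))
    at-tat x i = trans (at-t _ i) (cong T (trans (at-a _ i) (cong A (at-t x i))))

  d≤Km : ∀ {K} (type : ∀ {k} → Reachable k → Fin K) →
         (∀ {k k′} (p : Reachable k) (p′ : Reachable k′) → type p ≡ type p′ →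
           (∀ i → P (lookup k i) ≡ P (lookup k′ i)) → k ≡ k′) →
         d ≤ K ℕ.* m
  d≤Km type determined = injection-≤ (λ x → combine (type (reach x)) (ξ x)) λ x y eq →
    let same-type , same-ξ = FinP.combine-injective (type (reach x)) (ξ x) (type (reach y)) (ξ y) eq
    in el-inj x y (determined (reach x) (reach y) same-type (ξ-elim x y same-ξ))

  n≤d : ∀ {n} (k : Fin n → X) → (∀ y → Reachable (k y)) → Inj k → n ≤ d
  n≤d k k-reach k-inj = injection-≤ (λ y → index (k-reach y)) λ y z eq →
    k-inj y z (trans (sym (el-index (k-reach y))) (trans (cong el eq) (el-index (k-reach z))))

-- A family of permutation systems

-- On the residues modulo n, r is y ↦ - y, s is y ↦ -1 - y, and shift true, shift false
-- are y ↦ y - 1, y ↦ y + 1.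
module Dihedral (p : ℕ) where

  Y : Set
  Y = Fin (suc (suc p))

  r s : Y → Y
  r zero    = zero
  r (suc i) = suc (Fin.opposite i)
  s = Fin.opposite

  rr : ∀ y → r (r y) ≡ y
  rr zero    = refl
  rr (suc i) = cong suc (FinP.opposite-involutive i)

  ss : ∀ y → s (s y) ≡ y
  ss = FinP.opposite-involutive

  shift : Bool → Y → Y
  shift false y = r (s y)
  shift true  y = s (r y)

  shift-inverse : ∀ b y → shift (Bool.not b) (shift b y) ≡ y
  shift-inverse false y = trans (cong s (rr (s y))) (ss y)
  shift-inverse true  y = trans (cong r (ss (r y))) (rr y)

  shift-inj : ∀ b → Inj (shift b)
  shift-inj b x y eq = trans (sym (shift-inverse b x)) (trans (cong (shift (Bool.not b)) eq) (shift-inverse b y))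

  opposite-inject₁ : ∀ {n} (i : Fin n) → Fin.opposite (Fin.inject₁ i) ≡ suc (Fin.opposite i)
  opposite-inject₁ zero    = refl
  opposite-inject₁ (suc i) = cong Fin.inject₁ (opposite-inject₁ i)

  shift-inject₁ : ∀ i → shift false (Fin.inject₁ i) ≡ suc i
  shift-inject₁ i = trans (cong r (opposite-inject₁ i)) (cong suc (FinP.opposite-involutive i))

  run : Fin 3 → Y → Y
  run zero             y = y
  run (suc zero)       y = r y
  run (suc (suc zero)) y = s y

  flips : Fin 3 → Bool
  flips zero    = false
  flips (suc _) = true

  run-run : ∀ l y → run l (run l y) ≡ y
  run-run zero             y = refl
  run-run (suc zero)       y = rr y
  run-run (suc (suc zero)) y = ss y

  run-shift : ∀ l b y → run l (shift b y) ≡ shift (b xor flips l) (run l y)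
  run-shift zero             false y = refl
  run-shift zero             true  y = refl
  run-shift (suc zero)       false y = trans (rr (s y)) (cong s (sym (rr y)))
  run-shift (suc zero)       true  y = refl
  run-shift (suc (suc zero)) false y = refl
  run-shift (suc (suc zero)) true  y = trans (ss (r y)) (cong r (sym (ss y)))

  -- The dihedral maps: `ε (y + 1)` is `ε y + 1` for a rotation and `ε y - 1` for a reflection.
  Twisted : Bool → (Y → Y) → Set
  Twisted b ε = ∀ y → ε (shift false y) ≡ shift b (ε y)

  -- Agreement passes between `y` and `y + 1` in both directions: go down from `y₀` to `zero`, then
  -- up to every residue.
  twisted-agree : ∀ b {ε ε′} → Twisted b ε → Twisted b ε′ → ∀ y₀ → ε y₀ ≡ ε′ y₀ → ∀ y → ε y ≡ ε′ y
  twisted-agree b {ε} {ε′} tw tw′ y₀ eq = up (down y₀ eq)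
    where
    Agree : Y → Set
    Agree y = ε y ≡ ε′ y
    next : ∀ y → Agree y → Agree (shift false y)
    next y e = trans (tw y) (trans (cong (shift b) e) (sym (tw′ y)))
    prev : ∀ y → Agree (shift false y) → Agree y
    prev y e = shift-inj b _ _ (trans (sym (tw y)) (trans e (tw′ y)))
    up : Agree zero → ∀ y → Agree y
    up e = <-weakInduction Agree e λ i e′ → subst Agree (shift-inject₁ i) (next _ e′)
    down : ∀ y → Agree y → Agree zero
    down = <-weakInduction (λ y → Agree y → Agree zero) (λ e → e)
      λ i d e → d (prev _ (subst Agree (sym (shift-inject₁ i)) e))

  isZero : Y → Bool
  isZero zero    = true
  isZero (suc _) = false

  isZero-r : ∀ y → isZero (r y) ≡ isZero y
  isZero-r zero    = refl
  isZero-r (suc _) = refl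

  isZero⇒≡ : ∀ y → isZero y ≡ true → y ≡ zero
  isZero⇒≡ zero _ = refl

-- Found by a computer search: ρ is the dihedral part of T, and the zero of run (κ i) is
-- the point of block i that P singles out.
α τ φ : Fin 9 → Fin 9
α = lookup (Fin.# 1 ∷ Fin.# 2 ∷ Fin.# 0 ∷ Fin.# 4 ∷ Fin.# 5 ∷ Fin.# 3 ∷ Fin.# 7 ∷ Fin.# 8 ∷ Fin.# 6 ∷ [])
τ = lookup (Fin.# 0 ∷ Fin.# 3 ∷ Fin.# 6 ∷ Fin.# 1 ∷ Fin.# 4 ∷ Fin.# 5 ∷ Fin.# 2 ∷ Fin.# 7 ∷ Fin.# 8 ∷ [])
φ = lookup (Fin.# 0 ∷ Fin.# 2 ∷ Fin.# 1 ∷ Fin.# 6 ∷ Fin.# 8 ∷ Fin.# 7 ∷ Fin.# 3 ∷ Fin.# 5 ∷ Fin.# 4 ∷ [])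

ρ κ : Fin 9 → Fin 3
ρ = lookup (Fin.# 1 ∷ Fin.# 0 ∷ Fin.# 0 ∷ Fin.# 0 ∷ Fin.# 0 ∷ Fin.# 2 ∷ Fin.# 0 ∷ Fin.# 2 ∷ Fin.# 0 ∷ [])
κ = lookup (Fin.# 0 ∷ Fin.# 0 ∷ Fin.# 2 ∷ Fin.# 0 ∷ Fin.# 0 ∷ Fin.# 2 ∷ Fin.# 0 ∷ Fin.# 0 ∷ Fin.# 2 ∷ [])

ααα : ∀ i → α (α (α i)) ≡ i
ααα = toWitness {a? = all? λ i → α (α (α i)) FinP.≟ i} _

ττ : ∀ i → τ (τ i) ≡ i
ττ = toWitness {a? = all? λ i → τ (τ i) FinP.≟ i} _

ρτ : ∀ i → ρ (τ i) ≡ ρ i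
ρτ = toWitness {a? = all? λ i → ρ (τ i) FinP.≟ ρ i} _

φφ : ∀ i → φ (φ i) ≡ i
φφ = toWitness {a? = all? λ i → φ (φ i) FinP.≟ i} _

φα : ∀ i → φ (α i) ≡ α (α (φ i))
φα = toWitness {a? = all? λ i → φ (α i) FinP.≟ α (α (φ i))} _

φτ : ∀ i → φ (τ i) ≡ τ (φ i)
φτ = toWitness {a? = all? λ i → φ (τ i) FinP.≟ τ (φ i)} _

ρφ : ∀ i → ρ (φ i) ≡ ρ i
ρφ = toWitness {a? = all? λ i → ρ (φ i) FinP.≟ ρ i} _

-- Abstract, lest 18 ^ 9 be evaluated.
abstract
  types : ℕ
  types = 18 ℕ.^ 9

  toType : (Fin 9 → Fin 18) → Fin types
  toType = Fin.funToFin

  toType-inj : ∀ f g → toType f ≡ toType g → ∀ i → f i ≡ g i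
  toType-inj f g eq i = trans (sym (FinP.finToFun-funToFin f i))
    (trans (cong (λ c → Fin.finToFun c i) eq) (FinP.finToFun-funToFin g i))

module Family (p : ℕ) where
  open Dihedral p

  n Q : ℕ
  n = suc (suc p)
  Q = 9 ℕ.* n

  -- Points are to stay in the form `pt i y`, without unfolding the arithmetic of `combine`.
  abstract
    pt : Fin 9 → Y → Fin Q
    pt = combine

    blk : Fin Q → Fin 9
    blk q = proj₁ (remQuot {9} n q)

    pos : Fin Q → Y
    pos q = proj₂ (remQuot {9} n q)

    dec-pt : ∀ i y → (blk (pt i y) , pos (pt i y)) ≡ (i , y)
    dec-pt = FinP.remQuot-combine {9}

    pt-dec : ∀ q → pt (blk q) (pos q) ≡ q
    pt-dec = FinP.combine-remQuot {9} n

  onPt : ∀ {B : Set} (g : Fin 9 → Y → B) i y → g (blk (pt i y)) (pos (pt i y)) ≡ g i y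
  onPt g i y = cong (λ x → g (proj₁ x) (proj₂ x)) (dec-pt i y)

  pt-inj : ∀ {i j y z} → pt i y ≡ pt j z → i ≡ j × y ≡ z
  pt-inj {i} {j} {y} {z} eq = trans (sym (onPt (λ i y → i) i y)) (trans (cong blk eq) (onPt (λ i y → i) j z))
                            , trans (sym (onPt (λ i y → y) i y)) (trans (cong pos eq) (onPt (λ i y → y) j z))

  byPt : (R : Fin Q → Set) → (∀ i y → R (pt i y)) → ∀ q → R q
  byPt R h q = subst R (pt-dec q) (h (blk q) (pos q))

  A T F : Fin Q → Fin Q
  A q = pt (α (blk q)) (pos q)
  T q = pt (τ (blk q)) (run (ρ (blk q)) (pos q))
  F q = pt (φ (blk q)) (pos q)

  P : Fin Q → Bool
  P q = isZero (run (κ (blk q)) (pos q))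

  A-pt : ∀ i y → A (pt i y) ≡ pt (α i) y
  A-pt = onPt (λ i y → pt (α i) y)

  T-pt : ∀ i y → T (pt i y) ≡ pt (τ i) (run (ρ i) y)
  T-pt = onPt (λ i y → pt (τ i) (run (ρ i) y))

  F-pt : ∀ i y → F (pt i y) ≡ pt (φ i) y
  F-pt = onPt (λ i y → pt (φ i) y)

  P-pt : ∀ i y → P (pt i y) ≡ isZero (run (κ i) y)
  P-pt = onPt (λ i y → isZero (run (κ i) y))

  TAT-pt : ∀ i y → T (A (T (pt i y))) ≡ pt (τ (α (τ i))) (run (ρ (α (τ i))) (run (ρ i) y))
  TAT-pt i y = trans (cong (T ∘ A) (T-pt i y)) (trans (cong T (A-pt _ _)) (T-pt _ _))

  -- In each block both sides agree after cancelling two copies of `s` or using that `r` fixes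
  -- `zero`.
  P-tat : ∀ i y → isZero (run (κ (τ (α (τ i)))) (run (ρ (α (τ i))) (run (ρ i) y))) ≡ isZero (run (κ i) y)
  P-tat zero y = isZero-r y
  P-tat (suc zero) y = refl
  P-tat (suc (suc zero)) y = refl
  P-tat (suc (suc (suc zero))) y = refl
  P-tat (suc (suc (suc (suc zero)))) y = cong isZero (ss y)
  P-tat (suc (suc (suc (suc (suc zero))))) y = refl
  P-tat (suc (suc (suc (suc (suc (suc zero)))))) y = isZero-r y
  P-tat (suc (suc (suc (suc (suc (suc (suc zero))))))) y = cong isZero (ss y)
  P-tat (suc (suc (suc (suc (suc (suc (suc (suc zero)))))))) y = refl

  -- The map `TAT` also preserves the preimage of `P` under `A`, by the same two cancellations.
  P-atat : ∀ i y → isZero (run (κ (α (τ (α (τ i))))) (run (ρ (α (τ i))) (run (ρ i) y))) ≡ isZero (run (κ (α i)) y)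
  P-atat zero y = isZero-r y
  P-atat (suc zero) y = refl
  P-atat (suc (suc zero)) y = cong isZero (ss y)
  P-atat (suc (suc (suc zero))) y = refl
  P-atat (suc (suc (suc (suc zero)))) y = refl
  P-atat (suc (suc (suc (suc (suc zero))))) y = cong isZero (ss y)
  P-atat (suc (suc (suc (suc (suc (suc zero)))))) y = isZero-r y
  P-atat (suc (suc (suc (suc (suc (suc (suc zero))))))) y = refl
  P-atat (suc (suc (suc (suc (suc (suc (suc (suc zero)))))))) y = refl

  -- In block 2 the point singled out by `P` is the last one, not `zero`, as there are at least two
  -- residues. The images of `w₀` under `A`, `T` and `AT` are the zeros of blocks 0, 6 and 7, which
  -- do lie in `P`.
  w₀ : Fin Q
  w₀ = pt (Fin.# 2) zero

  differs : ∀ {q} i → q ≡ pt i zero → κ i ≡ zero → P q ≢ P w₀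
  differs i refl κ≡0 eq with () ← trans (sym (trans (P-pt i zero) (cong (λ l → isZero (run l zero)) κ≡0)))
                                        (trans eq (P-pt (Fin.# 2) zero))

  system : PermSystem Q
  system = record
    { A = A ; T = T ; F = F ; P = P
    ; AAA = byPt _ λ i y → trans (cong (A ∘ A) (A-pt i y)) (trans (cong A (A-pt _ y))
        (trans (A-pt _ y) (cong (λ j → pt j y) (ααα i))))
    ; TT = byPt _ λ i y → trans (cong T (T-pt i y)) (trans (T-pt _ _)
        (cong₂ pt (ττ i) (trans (cong (λ l → run l (run (ρ i) y)) (ρτ i)) (run-run (ρ i) y))))
    ; FF = byPt _ λ i y → trans (cong F (F-pt i y)) (trans (F-pt _ y) (cong (λ j → pt j y) (φφ i)))
    ; FA = byPt _ λ i y → trans (cong F (A-pt i y)) (trans (F-pt _ y) (trans (cong (λ j → pt j y) (φα i))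
        (sym (trans (cong (A ∘ A) (F-pt i y)) (trans (cong A (A-pt _ y)) (A-pt _ y))))))
    ; FT = byPt _ λ i y → trans (cong F (T-pt i y)) (trans (F-pt _ _)
        (trans (cong₂ (λ j l → pt j (run l y)) (φτ i) (sym (ρφ i)))
          (sym (trans (cong T (F-pt i y)) (T-pt _ y)))))
    ; P-tat = byPt _ λ i y → trans (cong P (TAT-pt i y)) (trans (P-pt _ _) (trans (P-tat i y) (sym (P-pt i y))))
    ; P-atat = byPt _ λ i y → trans (cong (P ∘ A) (TAT-pt i y)) (trans (cong P (A-pt _ _)) (trans (P-pt _ _)
        (trans (P-atat i y) (sym (trans (cong P (A-pt i y)) (P-pt _ y))))))
    ; P-a = w₀ , differs (Fin.# 0) (A-pt (Fin.# 2) zero) refl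
    ; P-t = w₀ , differs (Fin.# 6) (T-pt (Fin.# 2) zero) refl
    ; P-at = w₀ , differs (Fin.# 7) (trans (cong A (T-pt (Fin.# 2) zero)) (A-pt (Fin.# 6) zero)) refl }

  open FromPerms system using (Reachable; arcSystem; d≤Km; n≤d)

  arcs : ArcSystem
  arcs = arcSystem

  open ArcSystem arcs using (d; m)

  -- The part of an element of Dih(n) ≀ Sym(9) on one block: the target block and a dihedral map,
  -- with `b` telling rotations from reflections.
  record Block (k : Perm Q) (i : Fin 9) : Set where
    field
      σ    : Fin 9
      b    : Bool
      ε    : Y → Y
      form : ∀ y → lookup k (pt i y) ≡ pt σ (ε y)
      law  : Twisted b ε
      onto : ∀ y → ∃[ x ] ε x ≡ y

  block : ∀ {k} → Reachable k → ∀ i → Block k i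
  block start i = record
    { σ = i ; b = false ; ε = λ y → y ; form = λ y → VecP.lookup-allFin _
    ; law = λ y → refl ; onto = λ y → y , refl }
  block (viaA {k} q) i = record
    { σ = α σ ; b = b ; ε = ε
    ; form = λ y → trans (VecP.lookup-map _ A k) (trans (cong A (form y)) (A-pt _ _))
    ; law = law ; onto = onto }
    where open Block (block q i)
  block (viaT {k} q) i = record
    { σ = τ σ ; b = b xor flips (ρ σ) ; ε = run (ρ σ) ∘ ε
    ; form = λ y → trans (VecP.lookup-map _ T k) (trans (cong T (form y)) (T-pt _ _))
    ; law = λ y → trans (cong (run (ρ σ)) (law y)) (run-shift (ρ σ) b (ε y))
    ; onto = λ y → let x , eq = onto (run (ρ σ) y) in
        x , trans (cong (run (ρ σ)) eq) (run-run (ρ σ) y) }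
    where open Block (block q i)

  blockType : ∀ {k} → Reachable k → Fin 9 → Fin 18
  blockType q i = combine (Block.σ (block q i)) (bit (Block.b (block q i)))

  type : ∀ {k} → Reachable k → Fin types
  type q = toType (blockType q)

  -- P singles out one point of each block, and an element of a dihedral group is determined
  -- by one value once it is known to be a rotation or a reflection.
  determined : ∀ {k k′} (q : Reachable k) (q′ : Reachable k′) → type q ≡ type q′ →
               (∀ x → P (lookup k x) ≡ P (lookup k′ x)) → k ≡ k′
  determined {k} {k′} q q′ same-type same-P = lookup-ext (byPt _ λ i y → agree i y)
    where
    module _ (i : Fin 9) where
      module B = Block (block q i)
      module B′ = Block (block q′ i)
      same : B.σ ≡ B′.σ × bit B.b ≡ bit B′.b
      same = FinP.combine-injective B.σ (bit B.b) B′.σ (bit B′.b) (toType-inj (blockType q) (blockType q′) same-type i)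
      l = κ B.σ
      y₀ = proj₁ (B.onto (run l zero))
      ε-y₀ : B.ε y₀ ≡ run l zero
      ε-y₀ = proj₂ (B.onto (run l zero))
      P-k : ∀ y → P (lookup k (pt i y)) ≡ isZero (run l (B.ε y))
      P-k y = trans (cong P (B.form y)) (P-pt _ _)
      P-k′ : ∀ y → P (lookup k′ (pt i y)) ≡ isZero (run l (B′.ε y))
      P-k′ y = trans (cong P (B′.form y)) (trans (P-pt _ _)
        (cong (λ j → isZero (run (κ j) (B′.ε y))) (sym (proj₁ same))))
      zero-at : run l (B′.ε y₀) ≡ zero
      zero-at = isZero⇒≡ _ (trans (sym (P-k′ y₀)) (trans (sym (same-P _)) (trans (P-k y₀)
        (cong isZero (trans (cong (run l) ε-y₀) (run-run l zero))))))
      ε-agree : B.ε y₀ ≡ B′.ε y₀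
      ε-agree = trans ε-y₀ (trans (cong (run l) (sym zero-at)) (run-run l _))
      agree : ∀ y → lookup k (pt i y) ≡ lookup k′ (pt i y)
      agree y = trans (B.form y) (trans (cong₂ pt (proj₁ same)
        (twisted-agree B.b B.law (subst (λ b → Twisted b B′.ε) (sym (bit-inj (proj₂ same))) B′.law) y₀ ε-agree y))
        (sym (B′.form y)))

  d-bound : d ≤ types ℕ.* m
  d-bound = d≤Km type determined

  Sends : Fin 9 → Y → Set
  Sends i y = ∃[ k ] (Reachable k × lookup k (pt zero zero) ≡ pt i y)

  sendA : ∀ i {y} → Sends i y → Sends (α i) y
  sendA i (k , q , eq) = Vec.map A k , viaA q , trans (VecP.lookup-map _ A k) (trans (cong A eq) (A-pt _ _))

  sendT : ∀ i {y} → Sends i y → Sends (τ i) (run (ρ i) y)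
  sendT i (k , q , eq) = Vec.map T k , viaT q , trans (VecP.lookup-map _ T k) (trans (cong T eq) (T-pt _ _))

  sends : ∀ y → Sends zero y
  sends = <-weakInduction (Sends zero) (idPerm , start , VecP.lookup-allFin _) λ i h →
    -- Read from the inside, the word is A, T, A, A, T, A, T, A, A, T. It leads back to block 0 and
    -- meets just two nontrivial dihedral parts, `s` in block 5 and then `r` in block 0; together
    -- they add 1. Hence the group has at least `n` elements.
    subst (Sends zero) (shift-inject₁ i)
      (sendT (Fin.# 0) (sendA (Fin.# 2) (sendA (Fin.# 1) (sendT (Fin.# 3) (sendA (Fin.# 5)
        (sendT (Fin.# 5) (sendA (Fin.# 4) (sendA (Fin.# 3) (sendT (Fin.# 1) (sendA (Fin.# 0) h))))))))))

  n-bound : n ≤ d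
  n-bound = n≤d (λ y → proj₁ (sends y)) (λ y → proj₁ (proj₂ (sends y))) λ y z eq →
    proj₂ (pt-inj (trans (sym (proj₂ (proj₂ (sends y))))
      (trans (cong (λ k → lookup k (pt zero zero)) eq) (proj₂ (proj₂ (sends z))))))

-- Exponential growth

toℚ : ℕ → ℚ
toℚ n = (+ n) ℚ./ 1

-- Fractions are normalised by a gcd, so the identity is checked on unnormalised rationals.
toℚ-* : ∀ m n → toℚ (m ℕ.* n) ≡ toℚ m ℚ.* toℚ n
toℚ-* m n = ℚP.toℚᵘ-injective (ℚᵘP.≃-trans (ℚP.toℚᵘ-fromℚᵘ (mkℚᵘ (+ (m ℕ.* n)) 0))
  (ℚᵘP.≃-sym (ℚᵘP.≃-trans (ℚP.toℚᵘ-homo-* (toℚ m) (toℚ n))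
    (ℚᵘP.≃-trans (ℚᵘP.*-cong (ℚP.toℚᵘ-fromℚᵘ (mkℚᵘ (+ m) 0)) (ℚP.toℚᵘ-fromℚᵘ (mkℚᵘ (+ n) 0)))
      (*≡* (cong (ℤ._* + 1) (sym (ℤP.pos-* m n))))))))

toℚ-suc : ∀ n → toℚ (suc n) ≡ toℚ n ℚ.+ 1ℚ
toℚ-suc n = ℚP.toℚᵘ-injective (ℚᵘP.≃-trans (ℚP.toℚᵘ-fromℚᵘ (mkℚᵘ (+ suc n) 0))
  (ℚᵘP.≃-sym (ℚᵘP.≃-trans (ℚP.toℚᵘ-homo-+ (toℚ n) 1ℚ)
    (ℚᵘP.≃-trans (ℚᵘP.+-congˡ (ℚ.toℚᵘ 1ℚ) (ℚP.toℚᵘ-fromℚᵘ (mkℚᵘ (+ n) 0)))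
      (*≡* (cong (ℤ._* + 1) (trans (cong (ℤ._+ + 1) (ℤP.*-identityʳ (+ n)))
        (cong +_ (ℕP.+-comm n 1)))))))))

toℚ-mono : ∀ {m n} → m ≤ n → toℚ m ℚ.≤ toℚ n
toℚ-mono {m} {n} m≤n = ℚP.toℚᵘ-cancel-≤ (ℚᵘP.≤-trans
  (ℚᵘP.≤-reflexive (ℚP.toℚᵘ-fromℚᵘ (mkℚᵘ (+ m) 0)))
  (ℚᵘP.≤-trans (*≤* (ℤP.*-monoʳ-≤-nonNeg (+ 1) (ℤ.+≤+ m≤n)))
    (ℚᵘP.≤-reflexive (ℚᵘP.≃-sym (ℚP.toℚᵘ-fromℚᵘ (mkℚᵘ (+ n) 0))))))

unitFraction : ℕ → ℚ
unitFraction b = (+ 1) ℚ./ suc b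

unitFraction-inverse : ∀ b → unitFraction b ℚ.* toℚ (suc b) ≡ 1ℚ
unitFraction-inverse b = ℚP.toℚᵘ-injective (ℚᵘP.≃-trans (ℚP.toℚᵘ-homo-* (unitFraction b) (toℚ (suc b)))
  (ℚᵘP.≃-trans (ℚᵘP.*-cong (ℚP.toℚᵘ-fromℚᵘ (mkℚᵘ (+ 1) b)) (ℚP.toℚᵘ-fromℚᵘ (mkℚᵘ (+ suc b) 0)))
    (*≡* (trans (ℤP.*-identityʳ _) (cong +_ (trans (ℕP.+-identityʳ (suc b))
      (sym (trans (ℕP.+-identityʳ _) (ℕP.*-identityʳ (suc b))))))))))

unitFraction-positive : ∀ b → ℚ.Positive (unitFraction b)
unitFraction-positive b = ℚP.normalize-pos 1 (suc b)

-- With B = 2K the base is 1 + 1/B; from (1 + 1/B) i ≤ i + 1 for i ≤ B we get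
-- (1 + 1/B)^j i ≤ B whenever i + j = B, so (1 + 1/B)^K ≤ 2.
module Growth (K-1 : ℕ) where

  K B-1 B : ℕ
  K = suc K-1
  B-1 = K-1 ℕ.+ K
  B = suc B-1

  δ β : ℚ
  δ = unitFraction B-1
  β = 1ℚ ℚ.+ δ

  private instance
    δ-positive : ℚ.Positive δ
    δ-positive = unitFraction-positive B-1
    δ-nonNegative : ℚ.NonNegative δ
    δ-nonNegative = ℚP.pos⇒nonNeg δ
    β-positive : ℚ.Positive β
    β-positive = ℚP.pos+pos⇒pos 1ℚ δ
    β-nonNegative : ℚ.NonNegative β
    β-nonNegative = ℚP.pos⇒nonNeg β

  1<β : 1ℚ ℚ.< β
  1<β = subst (ℚ._< β) (ℚP.+-identityʳ 1ℚ) (ℚP.+-monoʳ-< 1ℚ (ℚP.positive⁻¹ δ))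

  ^-nonNegative : ∀ j → ℚ.NonNegative (β ^ℚ j)
  ^-nonNegative zero    = _
  ^-nonNegative (suc j) = ℚP.nonNeg*nonNeg⇒nonNeg β (β ^ℚ j) {{^-nonNegative j}}

  β*i≤1+i : ∀ i → i ≤ B → β ℚ.* toℚ i ℚ.≤ toℚ (suc i)
  β*i≤1+i i i≤B = begin
    β ℚ.* toℚ i                        ≡⟨ ℚP.*-distribʳ-+ (toℚ i) 1ℚ δ ⟩
    1ℚ ℚ.* toℚ i ℚ.+ δ ℚ.* toℚ i       ≡⟨ cong (ℚ._+ δ ℚ.* toℚ i) (ℚP.*-identityˡ (toℚ i)) ⟩
    toℚ i ℚ.+ δ ℚ.* toℚ i              ≤⟨ ℚP.+-monoʳ-≤ (toℚ i) (ℚP.*-monoˡ-≤-nonNeg δ (toℚ-mono i≤B)) ⟩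
    toℚ i ℚ.+ δ ℚ.* toℚ B              ≡⟨ cong (toℚ i ℚ.+_) (unitFraction-inverse B-1) ⟩
    toℚ i ℚ.+ 1ℚ                       ≡⟨ sym (toℚ-suc i) ⟩
    toℚ (suc i)                        ∎
    where open ℚP.≤-Reasoning

  β^j*i≤B : ∀ j i → i ℕ.+ j ≡ B → (β ^ℚ j) ℚ.* toℚ i ℚ.≤ toℚ B
  β^j*i≤B zero i eq = ℚP.≤-reflexive (trans (ℚP.*-identityˡ (toℚ i))
    (cong toℚ (trans (sym (ℕP.+-identityʳ i)) eq)))
  β^j*i≤B (suc j) i eq = begin
    (β ℚ.* (β ^ℚ j)) ℚ.* toℚ i  ≡⟨ cong (ℚ._* toℚ i) (ℚP.*-comm β (β ^ℚ j)) ⟩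
    ((β ^ℚ j) ℚ.* β) ℚ.* toℚ i  ≡⟨ ℚP.*-assoc (β ^ℚ j) β (toℚ i) ⟩
    (β ^ℚ j) ℚ.* (β ℚ.* toℚ i)  ≤⟨ ℚP.*-monoˡ-≤-nonNeg (β ^ℚ j) {{^-nonNegative j}}
                                     (β*i≤1+i i (ℕP.≤-trans (ℕP.m≤m+n i (suc j)) (ℕP.≤-reflexive eq))) ⟩
    (β ^ℚ j) ℚ.* toℚ (suc i)    ≤⟨ β^j*i≤B j (suc i) (trans (sym (ℕP.+-suc i j)) eq) ⟩
    toℚ B                       ∎
    where open ℚP.≤-Reasoning

  β^K≤2 : β ^ℚ K ℚ.≤ toℚ 2
  β^K≤2 = ℚP.*-cancelʳ-≤-pos (toℚ K) {{ℚP.normalize-pos K 1}} (begin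
    (β ^ℚ K) ℚ.* toℚ K  ≤⟨ β^j*i≤B K K refl ⟩
    toℚ B               ≡⟨ cong (toℚ ∘ (K ℕ.+_)) (sym (ℕP.+-identityʳ K)) ⟩
    toℚ (2 ℕ.* K)       ≡⟨ toℚ-* 2 K ⟩
    toℚ 2 ℚ.* toℚ K     ∎)
    where open ℚP.≤-Reasoning

  ^-+ : ∀ i j → β ^ℚ (i ℕ.+ j) ≡ (β ^ℚ i) ℚ.* (β ^ℚ j)
  ^-+ zero    j = sym (ℚP.*-identityˡ (β ^ℚ j))
  ^-+ (suc i) j = trans (cong (β ℚ.*_) (^-+ i j)) (sym (ℚP.*-assoc β (β ^ℚ i) (β ^ℚ j)))

  1≤^ : ∀ j → 1ℚ ℚ.≤ β ^ℚ j
  1≤^ zero    = ℚP.≤-refl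
  1≤^ (suc j) = begin
    1ℚ               ≤⟨ 1≤^ j ⟩
    β ^ℚ j           ≡⟨ sym (ℚP.*-identityˡ (β ^ℚ j)) ⟩
    1ℚ ℚ.* (β ^ℚ j)  ≤⟨ ℚP.*-monoʳ-≤-nonNeg (β ^ℚ j) {{^-nonNegative j}} (ℚP.<⇒≤ 1<β) ⟩
    β ℚ.* (β ^ℚ j)   ∎
    where open ℚP.≤-Reasoning

  ^-mono : ∀ {i j} → i ≤ j → β ^ℚ i ℚ.≤ β ^ℚ j
  ^-mono {i} {j} i≤j = begin
    β ^ℚ i                        ≡⟨ sym (ℚP.*-identityʳ (β ^ℚ i)) ⟩
    (β ^ℚ i) ℚ.* 1ℚ               ≤⟨ ℚP.*-monoˡ-≤-nonNeg (β ^ℚ i) {{^-nonNegative i}} (1≤^ (j ℕ.∸ i)) ⟩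
    (β ^ℚ i) ℚ.* (β ^ℚ (j ℕ.∸ i)) ≡⟨ sym (^-+ i (j ℕ.∸ i)) ⟩
    β ^ℚ (i ℕ.+ (j ℕ.∸ i))        ≡⟨ cong (β ^ℚ_) (ℕP.m+[n∸m]≡n i≤j) ⟩
    β ^ℚ j                        ∎
    where open ℚP.≤-Reasoning

  ^-bound : ∀ m → β ^ℚ (m ℕ.* K) ℚ.≤ toℚ (2 ℕ.^ m)
  ^-bound zero    = ℚP.≤-refl
  ^-bound (suc m) = begin
    β ^ℚ (K ℕ.+ m ℕ.* K)             ≡⟨ ^-+ K (m ℕ.* K) ⟩
    (β ^ℚ K) ℚ.* (β ^ℚ (m ℕ.* K))    ≤⟨ ℚP.*-monoʳ-≤-nonNeg (β ^ℚ (m ℕ.* K)) {{^-nonNegative (m ℕ.* K)}} β^K≤2 ⟩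
    toℚ 2 ℚ.* (β ^ℚ (m ℕ.* K))       ≤⟨ ℚP.*-monoˡ-≤-nonNeg (toℚ 2) (^-bound m) ⟩
    toℚ 2 ℚ.* toℚ (2 ℕ.^ m)          ≡⟨ sym (toℚ-* 2 (2 ℕ.^ m)) ⟩
    toℚ (2 ℕ.^ suc m)                ∎
    where open ℚP.≤-Reasoning

  -- The coefficient is 1/16, as `unitFraction` adds one to its argument; it absorbs the factor 16
  -- of `arcStab-bound`.
  exponential-bound : ∀ N m ℓ → N ≤ m ℕ.* K → 2 ℕ.^ m ≤ 16 ℕ.* ℓ →
                      unitFraction 15 ℚ.* (β ^ℚ N) ℚ.≤ toℚ ℓ
  exponential-bound N m ℓ N≤ 2^m≤ = begin
    unitFraction 15 ℚ.* (β ^ℚ N)            ≤⟨ ℚP.*-monoˡ-≤-nonNeg (unitFraction 15) (ℚP.≤-trans (^-mono N≤)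
                                                (ℚP.≤-trans (^-bound m) (toℚ-mono 2^m≤))) ⟩
    unitFraction 15 ℚ.* toℚ (16 ℕ.* ℓ)      ≡⟨ cong (unitFraction 15 ℚ.*_) (toℚ-* 16 ℓ) ⟩
    unitFraction 15 ℚ.* (toℚ 16 ℚ.* toℚ ℓ)  ≡⟨ sym (ℚP.*-assoc (unitFraction 15) (toℚ 16) (toℚ ℓ)) ⟩
    (unitFraction 15 ℚ.* toℚ 16) ℚ.* toℚ ℓ  ≡⟨ ℚP.*-identityˡ (toℚ ℓ) ⟩
    toℚ ℓ                                   ∎
    where open ℚP.≤-Reasoning

-- The family of pairs and its growth

module Pairs {L : PermGroup} {refl? tw : Bool} (local : LocalModel L refl? tw) (p : ℕ) where
  open Family p using (d-bound; n-bound)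
  open ArcSystem (Family.arcs p) using (d; m)
  open FromArcs (Family.arcs p) using (code; M≤d; d≤3M)
  open FromCode code local using (pair; arcStab-bound) public

  M : ℕ
  M = CubicCode.M code

  vertices-bound : M ℕ.* 2 ≤ m ℕ.* suc (types ℕ.* 2)
  vertices-bound = begin
    M ℕ.* 2                  ≤⟨ ℕP.*-monoˡ-≤ 2 (ℕP.≤-trans M≤d d-bound) ⟩
    types ℕ.* m ℕ.* 2        ≡⟨ cong (ℕ._* 2) (ℕP.*-comm types m) ⟩
    m ℕ.* types ℕ.* 2        ≡⟨ ℕP.*-assoc m types 2 ⟩
    -- The excess of one is there because `K` is a successor in `Growth`.
    m ℕ.* (types ℕ.* 2)      ≤⟨ ℕP.*-monoʳ-≤ m (ℕP.n≤1+n (types ℕ.* 2)) ⟩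
    m ℕ.* suc (types ℕ.* 2)  ∎
    where open ℕP.≤-Reasoning

  unbounded : ∀ b → b ℕ.* 3 ≤ p → b ≤ M ℕ.* 2
  unbounded b 3b≤p = ℕP.≤-trans
    (ℕP.*-cancelʳ-≤ b M 3 (ℕP.≤-trans 3b≤p (ℕP.≤-trans (ℕP.m≤n+m p 2) (ℕP.≤-trans n-bound d≤3M))))
    (ℕP.m≤m*n M 2)

-- The base depends only on `types`, hence neither on the member of the family nor on `L`. The
-- member with index `3 b` has at least `b` vertices.
exponentialType : ∀ {L refl? tw} → LocalModel L refl? tw → ExponentialType L
exponentialType local =
  unitFraction 15 , β , ℚP.positive⁻¹ (unitFraction 15) , 1<β , pair ,
  (λ b → b ℕ.* 3 , unbounded (b ℕ.* 3) b ℕP.≤-refl) ,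
  λ p u v uv → exponential-bound (M p ℕ.* 2) (dim p) (length (arcStab (G (pair p)) u v))
    (vertices-bound p) (arcStab-bound p u v uv)
  where
  open Growth (types ℕ.* 2)
  open Pairs local
  dim : ℕ → ℕ
  dim p = ArcSystem.m (Family.arcs p)

theorem1p1 : ExponentialType A4[6] × ExponentialType S4[6d] × ExponentialType S4[6c]
theorem1p1 = exponentialType A4[6]-model , exponentialType S4[6d]-model , exponentialType S4[6c]-model
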